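{- Let $n\geq 3$ be an integer and let $G$ be a tree on $n$ vertices. Then $G$ has the maximum tenacity among all trees on $n$ vertices if and only if: (i) when $n$ is even, $G$ is a path; (ii) when $n$ is odd, the maximum degree of $G$ is at most $3$ and $G$ contains no two nonadjacent vertices of degree $3$.
   Context: All graphs are finite and simple. For a graph $G$, $\omega(G)$ denotes the number of components of $G$ and $\tau(G)$ the order of a largest component of $G$. The tenacity of a noncomplete connected graph $G$ is $T(G)=\min\left\{\frac{|X|+\tau(G-X)}{\omega(G-X)} : X\subset V(G),\ \omega(G-X)>1\right\}$. -}

module Defs where

open import Data.Nat using (ℕ; zero; suc; _+_; _*_; _∸_; _≤_; _<ᵇ_; _≡ᵇ_; _⊔_; _%_)
import Data.Nat
import Data.Fin as Fin
open import Data.Fin using (Fin; toℕ)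
open import Data.Bool using (Bool; true; false; _∧_; _∨_; not; if_then_else_)
open import Data.Product using (Σ; _×_; _,_)
open import Data.Sum using (_⊎_)
open import Data.Integer using (+_)
open import Data.Rational.Unnormalised using (ℚᵘ; mkℚᵘ) renaming (_≤_ to _≤ℚ_)
open import Data.Fin.Permutation using (Permutation′; _⟨$⟩ʳ_)
open import Relation.Binary.PropositionalEquality using (_≡_; _≢_)
open import Relation.Nullary using (¬_)

record Graph (n : ℕ) : Set where
  field
    adj     : Fin n → Fin n → Bool
    sym     : ∀ u v → adj u v ≡ adj v u
    irrefl  : ∀ v → adj v v ≡ false
open Graph public

VSet : ℕ → Set
VSet n = Fin n → Bool

anyFin : ∀ {n} → (Fin n → Bool) → Bool
anyFin {zero}  f = false
anyFin {suc n} f = f Fin.zero ∨ anyFin (λ i → f (Fin.suc i))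

countFin : ∀ {n} → (Fin n → Bool) → ℕ
countFin {zero}  f = 0
countFin {suc n} f = (if f Fin.zero then 1 else 0) + countFin (λ i → f (Fin.suc i))

maxFin : ∀ {n} → (Fin n → ℕ) → ℕ
maxFin {zero}  f = 0
maxFin {suc n} f = f Fin.zero ⊔ maxFin (λ i → f (Fin.suc i))

card : ∀ {n} → VSet n → ℕ
card X = countFin X

deg : ∀ {n} → Graph n → Fin n → ℕ
deg G v = countFin (adj G v)

sumFin : ∀ {n} → (Fin n → ℕ) → ℕ
sumFin {zero}  f = 0
sumFin {suc n} f = f Fin.zero + sumFin (λ i → f (Fin.suc i))

edgeCount : ∀ {n} → Graph n → ℕ
edgeCount G = sumFin (λ u → countFin (λ v → (toℕ u <ᵇ toℕ v) ∧ adj G u v))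

step : ∀ {n} → Graph n → VSet n → VSet n → VSet n
step G X S u = S u ∨ (not (X u) ∧ anyFin (λ w → S w ∧ adj G w u))

iter : ∀ {n} → ℕ → (VSet n → VSet n) → VSet n → VSet n
iter zero    f S = S
iter (suc k) f S = f (iter k f S)

-- comp G X v : the vertex set of the component of G - X containing v
-- (empty if v ∈ X). Iterating n times reaches all vertices joined to v by
-- a path in G - X, since such paths have fewer than n edges.
comp : ∀ {n} → Graph n → VSet n → Fin n → VSet n
comp {n} G X v = iter n (step G X) (λ u → (toℕ u ≡ᵇ toℕ v) ∧ not (X v))

-- ω(G - X): number of components of G - X (counted via their least vertex)
ω : ∀ {n} → Graph n → VSet n → ℕ
ω G X = countFin (λ v → not (X v) ∧ not (anyFin (λ u → comp G X v u ∧ (toℕ u <ᵇ toℕ v))))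

τ : ∀ {n} → Graph n → VSet n → ℕ
τ G X = maxFin (λ v → if X v then 0 else card (comp G X v))

emptySet : ∀ {n} → VSet n
emptySet _ = false

Connected : ∀ {n} → Graph n → Set
Connected G = ∀ u v → comp G emptySet u v ≡ true

IsTree : ∀ {n} → Graph n → Set
IsTree {n} G = Connected G × edgeCount G ≡ n ∸ 1

-- (|X| + τ(G - X)) / ω(G - X), as an unnormalised rational; only used when
-- ω(G - X) > 1, where mkℚᵘ a (ω ∸ 1) denotes a / ω.
ratio : ∀ {n} → Graph n → VSet n → ℚᵘ
ratio G X = mkℚᵘ (+ (card X + τ G X)) (ω G X ∸ 1)

IsTenacity : ∀ {n} → Graph n → ℚᵘ → Set
IsTenacity G t =
  (Σ (VSet _) λ X → (1 Data.Nat.< ω G X) × ratio G X ≡ t)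
  × (∀ X → 1 Data.Nat.< ω G X → t ≤ℚ ratio G X)

HasMaxTenacityAmongTrees : ∀ {n} → Graph n → Set
HasMaxTenacityAmongTrees {n} G =
  Σ ℚᵘ λ t → IsTenacity G t ×
    (∀ (H : Graph n) → IsTree H → ∀ s → IsTenacity H s → s ≤ℚ t)

IsPath : ∀ {n} → Graph n → Set
IsPath {n} G = Σ (Permutation′ n) λ σ → ∀ i j →
  (adj G (σ ⟨$⟩ʳ i) (σ ⟨$⟩ʳ j) ≡ true → (suc (toℕ i) ≡ toℕ j ⊎ suc (toℕ j) ≡ toℕ i))
  × ((suc (toℕ i) ≡ toℕ j ⊎ suc (toℕ j) ≡ toℕ i) → adj G (σ ⟨$⟩ʳ i) (σ ⟨$⟩ʳ j) ≡ true)

OddCondition : ∀ {n} → Graph n → Set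
OddCondition G =
  (∀ v → deg G v ≤ 3)
  × (∀ u v → u ≢ v → deg G u ≡ 3 → deg G v ≡ 3 → adj G u v ≡ true)

{-# OPTIONS --safe #-}
module Submission where

-- Root the tree. The components of G - X correspond to their topmost vertices,
-- and double counting parent edges gives
--   ω(G - X) + |X| + e(X) = 1 + Σ_{x ∈ X} deg x ,
-- where e(X) is the number of edges inside X. The smaller bipartition class
-- shows that no tenacity exceeds 1 (n odd) or (n + 2) / n (n even). For paths,
-- and for trees satisfying the odd condition, the identity bounds ω by |X| + 1
-- and |X| + 2 respectively, and distinguishing τ = 1 from τ ≥ 2 shows that the
-- bound is attained. Otherwise a vertex of large degree, or two nonadjacent
-- ones of degree 3, allow a set X with τ(G - X) ≤ 2 in which every vertex
-- contributes deg x - 2 - [parent of x in X] ≥ 0 and the given vertices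
-- contribute enough to push the ratio below the bound.

open import Defs
open import Algebra.Properties.CommutativeSemigroup using (interchange)
open import Data.Bool using (Bool; true; false; _∧_; _∨_; not; if_then_else_)
open import Data.Bool.Properties using (∧-zeroʳ; ∨-zeroʳ; ∨-comm; ¬-not; T-≡; not-involutive)
open import Data.Empty using (⊥; ⊥-elim)
open import Data.Fin using (Fin; zero; suc; toℕ; fromℕ<; inject₁)
open import Data.Fin.Permutation using (permutation; _⟨$⟩ʳ_; _⟨$⟩ˡ_; inverseʳ)
import Data.Fin.Permutation as Perm
import Data.Fin.Properties as Fin
import Data.Integer as ℤ
import Data.Integer.Properties as ℤ
open import Data.Nat using (ℕ; zero; suc; _+_; _*_; _∸_; _≤_; _<_; _≡ᵇ_; _<ᵇ_; _%_; _/_; z≤n; s≤s)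
open import Data.Nat.DivMod using (m≡m%n+[m/n]*n)
open import Data.Nat.Properties
open import Data.Nat.Solver using (module +-*-Solver)
open import Data.Product using (Σ; ∃; _×_; _,_; proj₁; proj₂)
open import Data.Rational.Unnormalised using (ℚᵘ; mkℚᵘ; *≤*) renaming (_≤_ to _≤ℚ_)
import Data.Rational.Unnormalised.Properties as ℚ
import Data.Sum as Sum
open import Data.Sum using (_⊎_; inj₁; inj₂)
open import Function.Bundles using (_⇔_; mk⇔; Equivalence)
open import Relation.Binary.Definitions using (tri<; tri≈; tri>)
open import Relation.Binary.PropositionalEquality using (_≡_; _≢_; refl; trans; cong; cong₂; subst; module ≡-Reasoning) renaming (sym to ≡-sym)
open import Relation.Nullary using (¬_; does; yes; no)

-- The values 1 and (n + 2)/n come from the smaller bipartition class X: all components of G - X are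
-- single vertices, so the ratio is at most (|X| + 1)/(n - |X|), and |X| ≤ h turns this into (h +
-- 1)/(h + 1) for n = 2h + 1 and (h + 1)/h for n = 2h.
--
-- Rearranged, the identity says that ω(G - X) - |X| - 1 is the sum over X of deg x - 2 -
-- [parent of x in X]. A set with τ ≤ 2 and total contribution c therefore has ratio at most (|X| +
-- 2)/(|X| + 1 + c). For even n, c = 1 suffices, so one vertex of degree 3 is already too much; for
-- odd n, c = 2 is required, and two adjacent vertices of degree 3 do not supply it because the edge
-- between them costs 1.
--
-- The obstacle is to extend the given vertices to a set X without negative contributions (no leaf,
-- no vertex of degree 2 with its parent in X) whose removal leaves pieces of at most two vertices.
-- For one given vertex a greedy choice from the root works. For two vertices of degree 3 it may
-- take the parent of the second one and lose its contribution, hence the two constructions by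
-- parity of the distance.

private variable
  n m : ℕ

-- Booleans, finite search and maxima

⟦_⟧ : Bool → ℕ
⟦ b ⟧ = if b then 1 else 0

⟦⟧≤1 : ∀ b → ⟦ b ⟧ ≤ 1
⟦⟧≤1 true  = ≤-refl
⟦⟧≤1 false = z≤n

∧-true : ∀ {a b} → a ∧ b ≡ true → a ≡ true × b ≡ true
∧-true {true} {true} _ = refl , refl

∧-intro : ∀ {a b} → a ≡ true → b ≡ true → a ∧ b ≡ true
∧-intro refl refl = refl

∨-true : ∀ {a b} → a ∨ b ≡ true → a ≡ true ⊎ b ≡ true
∨-true {true}  _ = inj₁ refl
∨-true {false} p = inj₂ p

not-true : ∀ {b} → not b ≡ true → b ≡ false
not-true {false} _ = refl

not-false : ∀ {b} → not b ≡ false → b ≡ true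
not-false {true} _ = refl

clash : ∀ {b} {A : Set} → b ≡ true → b ≡ false → A
clash refl ()

anyFin-intro : (f : Fin n → Bool) → ∀ i → f i ≡ true → anyFin f ≡ true
anyFin-intro f zero    p rewrite p = refl
anyFin-intro f (suc i) p with f zero
... | true  = refl
... | false = anyFin-intro (λ j → f (suc j)) i p

anyFin-elim : (f : Fin n → Bool) → anyFin f ≡ true → ∃ λ i → f i ≡ true
anyFin-elim {suc n} f p with f zero in eq
... | true  = zero , eq
... | false = let i , q = anyFin-elim (λ j → f (suc j)) p in suc i , q

anyFin-least : (f : Fin n → Bool) → anyFin f ≡ true →
  ∃ λ i → f i ≡ true × (∀ j → f j ≡ true → toℕ i ≤ toℕ j)
anyFin-least {suc n} f p with f zero in eq
... | true  = zero , eq , λ _ _ → z≤n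
... | false with anyFin-least (λ j → f (suc j)) p
...   | i , q , least = suc i , q , λ { zero r → clash r eq ; (suc j) r → s≤s (least j r) }

all-or-any : (f : Fin n → Bool) → (∀ i → f i ≡ false) ⊎ (∃ λ i → f i ≡ true)
all-or-any f with anyFin f in eq
... | true  = inj₂ (anyFin-elim f eq)
... | false = inj₁ λ i → ¬-not λ p → clash (anyFin-intro f i p) eq

≤-maxFin : (f : Fin n → ℕ) → ∀ i → f i ≤ maxFin f
≤-maxFin f zero    = m≤m⊔n _ _
≤-maxFin f (suc i) = ≤-trans (≤-maxFin (λ j → f (suc j)) i) (m≤n⊔m _ _)

maxFin-≤ : (f : Fin n → ℕ) → ∀ {c} → (∀ i → f i ≤ c) → maxFin f ≤ c
maxFin-≤ {zero}  f p = z≤n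
maxFin-≤ {suc n} f p = ⊔-lub (p zero) (maxFin-≤ (λ j → f (suc j)) (λ j → p (suc j)))

-- Finite sums

sum-cong : {f g : Fin n → ℕ} → (∀ i → f i ≡ g i) → sumFin f ≡ sumFin g
sum-cong {zero}  p = refl
sum-cong {suc n} p = cong₂ _+_ (p zero) (sum-cong (λ i → p (suc i)))

sum-mono : {f g : Fin n → ℕ} → (∀ i → f i ≤ g i) → sumFin f ≤ sumFin g
sum-mono {zero}  p = z≤n
sum-mono {suc n} p = +-mono-≤ (p zero) (sum-mono (λ i → p (suc i)))

sum-+ : (f g : Fin n → ℕ) → sumFin (λ i → f i + g i) ≡ sumFin f + sumFin g
sum-+ {zero}  f g = refl
sum-+ {suc n} f g = trans
  (cong (f zero + g zero +_) (sum-+ (λ i → f (suc i)) (λ i → g (suc i))))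
  (interchange +-commutativeSemigroup (f zero) (g zero) _ _)

sum-const : ∀ n c → sumFin {n} (λ _ → c) ≡ n * c
sum-const zero    c = refl
sum-const (suc n) c = cong (c +_) (sum-const n c)

sum-zero : ∀ n → sumFin {n} (λ _ → 0) ≡ 0
sum-zero n = trans (sum-const n 0) (*-zeroʳ n)

sum-swap : (f : Fin n → Fin m → ℕ) →
  sumFin (λ i → sumFin (f i)) ≡ sumFin (λ j → sumFin (λ i → f i j))
sum-swap {zero}  {m} f = ≡-sym (sum-zero m)
sum-swap {suc n} f = trans
  (cong (sumFin (f zero) +_) (sum-swap (λ i → f (suc i))))
  (≡-sym (sum-+ (f zero) _))

-- One strict term would make the whole sum strict. This turns a global count into termwise
-- information: applied to rows and then within a row, it shows that a tree has no edges besides its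
-- parent edges.
sum-tight : {f g : Fin n → ℕ} → (∀ i → f i ≤ g i) → sumFin g ≤ sumFin f → ∀ i → f i ≡ g i
sum-tight {suc n} {f} {g} p q zero = ≤-antisym (p zero) (≮⇒≥ λ lt →
  <-irrefl refl (<-≤-trans (+-mono-<-≤ lt (sum-mono (λ i → p (suc i)))) q))
sum-tight {suc n} {f} {g} p q (suc i) = sum-tight (λ j → p (suc j)) (≮⇒≥ λ lt →
  <-irrefl refl (<-≤-trans (+-mono-≤-< (p zero) lt) q)) i

count≡sum : (f : Fin n → Bool) → countFin f ≡ sumFin (λ i → ⟦ f i ⟧)
count≡sum {zero}  f = refl
count≡sum {suc n} f = cong (⟦ f zero ⟧ +_) (count≡sum (λ i → f (suc i)))

_==_ : Fin n → Fin n → Bool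
i == j = does (i Fin.≟ j)

==-refl : (i : Fin n) → i == i ≡ true
==-refl i with i Fin.≟ i
... | yes _ = refl
... | no ¬p = ⊥-elim (¬p refl)

==⇒≡ : {i j : Fin n} → i == j ≡ true → i ≡ j
==⇒≡ {i = i} {j} p with i Fin.≟ j
... | yes q = q

≢⇒== : {i j : Fin n} → i ≢ j → i == j ≡ false
≢⇒== ne = ¬-not λ p → ne (==⇒≡ p)

sum-pick : (i : Fin n) (f : Fin n → ℕ) → sumFin (λ j → if i == j then f j else 0) ≡ f i
sum-pick {suc n} zero    f = trans (cong (f zero +_) (sum-zero n)) (+-identityʳ _)
sum-pick {suc n} (suc i) f = sum-pick i (λ j → f (suc j))

count-== : (i : Fin n) → sumFin (λ j → ⟦ i == j ⟧) ≡ 1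
count-== i = sum-pick i (λ _ → 1)

count-mono : {f g : Fin n → Bool} → (∀ i → f i ≡ true → g i ≡ true) → countFin f ≤ countFin g
count-mono {f = f} {g} p rewrite count≡sum f | count≡sum g = sum-mono pointwise
  where
  pointwise : ∀ i → ⟦ f i ⟧ ≤ ⟦ g i ⟧
  pointwise i with f i in eq
  ... | false = z≤n
  ... | true rewrite p i eq = ≤-refl

count-cong : {f g : Fin n → Bool} → (∀ i → f i ≡ g i) → countFin f ≡ countFin g
count-cong {f = f} {g} p rewrite count≡sum f | count≡sum g = sum-cong λ i → cong ⟦_⟧ (p i)

count-empty : {f : Fin n → Bool} → (∀ i → f i ≡ false) → countFin f ≡ 0
count-empty {n} {f} p = trans (count≡sum f) (trans (sum-cong λ i → cong ⟦_⟧ (p i)) (sum-zero n))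

count-not : (f : Fin n → Bool) → countFin f + countFin (λ i → not (f i)) ≡ n
count-not {n} f rewrite count≡sum f | count≡sum (λ i → not (f i)) = begin
  sumFin (λ i → ⟦ f i ⟧) + sumFin (λ i → ⟦ not (f i) ⟧) ≡⟨ sum-+ (λ i → ⟦ f i ⟧) (λ i → ⟦ not (f i) ⟧) ⟨
  sumFin (λ i → ⟦ f i ⟧ + ⟦ not (f i) ⟧)                ≡⟨ sum-cong (λ i → one (f i)) ⟩
  sumFin {n} (λ _ → 1)                                  ≡⟨ sum-const n 1 ⟩
  n * 1                                                 ≡⟨ *-identityʳ n ⟩
  n                                                     ∎
  where
  open ≡-Reasoning
  one : ∀ b → ⟦ b ⟧ + ⟦ not b ⟧ ≡ 1
  one true  = refl
  one false = refl

count-full : (f : Fin n → Bool) → n ≤ countFin f → ∀ i → f i ≡ true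
count-full {n} f p i with f i in eq
... | true  = refl
... | false = ⊥-elim (0≢1 (trans (≡-sym (cong ⟦_⟧ eq)) (sum-tight (λ j → ⟦⟧≤1 (f j)) full i)))
  where
  0≢1 : 0 ≢ 1
  0≢1 ()
  full : sumFin {n} (λ _ → 1) ≤ sumFin (λ j → ⟦ f j ⟧)
  full rewrite sum-const n 1 | *-identityʳ n | ≡-sym (count≡sum f) = p

count-∃ : (f : Fin n → Bool) → 0 < countFin f → ∃ λ i → f i ≡ true
count-∃ f p with all-or-any f
... | inj₂ q = q
... | inj₁ q = ⊥-elim (<-irrefl (≡-sym (count-empty q)) p)

count-suc : {f g : Fin n → Bool} (i : Fin n) → f i ≡ false → g i ≡ true →
  (∀ j → f j ≡ true → g j ≡ true) → suc (countFin f) ≤ countFin g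
count-suc {f = f} {g} i fi gi p rewrite count≡sum f | count≡sum g =
  subst (_≤ sumFin (λ j → ⟦ g j ⟧))
    (trans (sum-+ (λ j → ⟦ i == j ⟧) (λ j → ⟦ f j ⟧)) (cong (_+ sumFin (λ j → ⟦ f j ⟧)) (count-== i)))
    (sum-mono pointwise)
  where
  pointwise : ∀ j → ⟦ i == j ⟧ + ⟦ f j ⟧ ≤ ⟦ g j ⟧
  pointwise j with i Fin.≟ j
  ... | yes refl rewrite fi | gi = ≤-refl
  ... | no _ with f j in eq
  ...   | false = z≤n
  ...   | true rewrite p j eq = ≤-refl

count-unique : (f : Fin n → Bool) → (∀ i j → f i ≡ true → f j ≡ true → i ≡ j) → countFin f ≤ 1
count-unique f p with all-or-any f
... | inj₁ q rewrite count-empty q = z≤n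
... | inj₂ (i , fi) = ≤-trans (count-mono λ j fj → subst (λ k → i == k ≡ true) (p i j fi fj) (==-refl i))
                              (≤-reflexive (trans (count≡sum (i ==_)) (count-== i)))

_∖_ : (Fin n → Bool) → Fin n → (Fin n → Bool)
(f ∖ i) j = f j ∧ not (i == j)

∖-≢ : (f : Fin n → Bool) {i j : Fin n} → i ≢ j → f j ≡ true → (f ∖ i) j ≡ true
∖-≢ f ne p rewrite ≢⇒== ne | p = refl

count-∖ : (f : Fin n → Bool) (i : Fin n) → f i ≡ true → suc (countFin (f ∖ i)) ≤ countFin f
count-∖ f i fi = count-suc i i∉ fi (λ j q → proj₁ (∧-true q))
  where
  i∉ : (f ∖ i) i ≡ false
  i∉ rewrite ==-refl i = ∧-zeroʳ (f i)

count-≤-∖ : (f : Fin n → Bool) (i : Fin n) → countFin f ≤ suc (countFin (f ∖ i))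
count-≤-∖ f i rewrite count≡sum f | count≡sum (f ∖ i) =
  subst (sumFin (λ j → ⟦ f j ⟧) ≤_)
    (trans (sum-+ (λ j → ⟦ i == j ⟧) (λ j → ⟦ (f ∖ i) j ⟧)) (cong (_+ sumFin (λ j → ⟦ (f ∖ i) j ⟧)) (count-== i)))
    (sum-mono λ j → pointwise (f j) (i == j))
  where
  pointwise : ∀ a b → ⟦ a ⟧ ≤ ⟦ b ⟧ + ⟦ a ∧ not b ⟧
  pointwise false b     = z≤n
  pointwise true  true  = s≤s z≤n
  pointwise true  false = ≤-refl

count-two : (f : Fin n → Bool) {i j : Fin n} → i ≢ j → f i ≡ true → f j ≡ true → 2 ≤ countFin f
count-two f {i} {j} ne fi fj = ≤-trans (s≤s (≤-trans (s≤s z≤n) (count-∖ (f ∖ i) j (∖-≢ f ne fj)))) (count-∖ f i fi)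

count-three : (f : Fin n → Bool) {i j k : Fin n} → i ≢ j → i ≢ k → j ≢ k →
  f i ≡ true → f j ≡ true → f k ≡ true → 3 ≤ countFin f
count-three f {i} ij ik jk fi fj fk =
  ≤-trans (s≤s (count-two (f ∖ i) jk (∖-≢ f ij fj) (∖-≢ f ik fk))) (count-∖ f i fi)

-- The elements of `f` are regrouped by their image: the fibre over `j` has at most one element, and
-- none unless `g j` holds.
count-injection : (f g : Fin n → Bool) (h : Fin n → Fin n) →
  (∀ i → f i ≡ true → g (h i) ≡ true) →
  (∀ i j → f i ≡ true → f j ≡ true → h i ≡ h j → i ≡ j) →
  countFin f ≤ countFin g
count-injection {n} f g h into inj = begin
  countFin f                                              ≡⟨ count≡sum f ⟩
  sumFin (λ i → ⟦ f i ⟧)                                  ≡⟨ sum-cong (λ i → sum-pick (h i) (λ _ → ⟦ f i ⟧)) ⟨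
  sumFin (λ i → sumFin (λ j → if h i == j then ⟦ f i ⟧ else 0)) ≡⟨ sum-swap (λ i j → if h i == j then ⟦ f i ⟧ else 0) ⟩
  sumFin (λ j → sumFin (λ i → if h i == j then ⟦ f i ⟧ else 0)) ≤⟨ sum-mono fibre ⟩
  sumFin (λ j → ⟦ g j ⟧)                                  ≡⟨ count≡sum g ⟨
  countFin g                                              ∎
  where
  open ≤-Reasoning
  merge : ∀ a b → (if a then ⟦ b ⟧ else 0) ≡ ⟦ a ∧ b ⟧
  merge true  b = refl
  merge false b = refl
  fibre : ∀ j → sumFin (λ i → if h i == j then ⟦ f i ⟧ else 0) ≤ ⟦ g j ⟧
  fibre j rewrite sum-cong {f = λ i → if h i == j then ⟦ f i ⟧ else 0} (λ i → merge (h i == j) (f i))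
                | ≡-sym (count≡sum (λ i → (h i == j) ∧ f i)) with g j in eq
  ... | true  = count-unique _ λ i k p q → let hi , fi = ∧-true p ; hk , fk = ∧-true q in
                  inj i k fi fk (trans (==⇒≡ hi) (≡-sym (==⇒≡ hk)))
  ... | false = ≤-reflexive (count-empty λ i → ¬-not λ p → let hi , fi = ∧-true p in
                  clash (subst (λ k → g k ≡ true) (==⇒≡ hi) (into i fi)) eq)

-- Components of G - X

≡ᵇ-true : ∀ {a b} → (a ≡ᵇ b) ≡ true → a ≡ b
≡ᵇ-true {a} {b} p = ≡ᵇ⇒≡ a b (Equivalence.from T-≡ p)

≡ᵇ-refl : ∀ {a b} → a ≡ b → (a ≡ᵇ b) ≡ true
≡ᵇ-refl {a} {b} p = Equivalence.to T-≡ (≡⇒≡ᵇ a b p)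

<ᵇ-true : ∀ {a b} → (a <ᵇ b) ≡ true → a < b
<ᵇ-true {a} {b} p = <ᵇ⇒< a b (Equivalence.from T-≡ p)

<ᵇ-intro : ∀ {a b} → a < b → (a <ᵇ b) ≡ true
<ᵇ-intro p = Equivalence.to T-≡ (<⇒<ᵇ p)

<ᵇ-false : ∀ {a b} → (a <ᵇ b) ≡ false → b ≤ a
<ᵇ-false p = ≮⇒≥ λ lt → clash (<ᵇ-intro lt) p

module Component (G : Graph n) (X : VSet n) where

  step-elim : ∀ S {u} → step G X S u ≡ true →
    S u ≡ true ⊎ (X u ≡ false × ∃ λ w → S w ≡ true × adj G w u ≡ true)
  step-elim S {u} p with ∨-true {S u} p
  ... | inj₁ q = inj₁ q
  ... | inj₂ q with ∧-true {not (X u)} q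
  ...   | q₁ , q₂ with anyFin-elim _ q₂
  ...     | w , r = inj₂ (not-true q₁ , w , ∧-true r)

  step-stay : ∀ S {u} → S u ≡ true → step G X S u ≡ true
  step-stay S p rewrite p = refl

  step-move : ∀ S {u w} → S w ≡ true → adj G w u ≡ true → X u ≡ false → step G X S u ≡ true
  step-move S {u} {w} p q r with S u
  ... | true  = refl
  ... | false rewrite r = anyFin-intro _ w (∧-intro p q)

  module _ (v : Fin n) where

    layer : ℕ → VSet n
    layer k = iter k (step G X) (λ u → (toℕ u ≡ᵇ toℕ v) ∧ not (X v))

    layer-zero : ∀ {u} → layer 0 u ≡ true → u ≡ v × X v ≡ false
    layer-zero p = let q , r = ∧-true p in Fin.toℕ-injective (≡ᵇ-true q) , not-true r

    layer-mono : ∀ {j k u} → j ≤ k → layer j u ≡ true → layer k u ≡ true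
    layer-mono {j} {k} {u} j≤k p = subst (λ i → layer i u ≡ true) (m∸n+n≡m j≤k) (climb (k ∸ j))
      where
      climb : ∀ d → layer (d + j) u ≡ true
      climb zero    = p
      climb (suc d) = step-stay (layer (d + j)) (climb d)

    Stable : ℕ → Set
    Stable k = ∀ u → layer (suc k) u ≡ true → layer k u ≡ true

    stable-suc : ∀ k → Stable k → Stable (suc k)
    stable-suc k st u p with step-elim (layer (suc k)) p
    ... | inj₁ q = q
    ... | inj₂ (u∉X , w , q , e) = step-move (layer k) (st w q) e u∉X

    -- Until they stabilise, the layers gain a vertex at every step.
    stable-or-large : ∀ k → Stable k ⊎ k ≤ card (layer k)
    stable-or-large zero = inj₂ z≤n
    stable-or-large (suc k) with stable-or-large k
    ... | inj₁ st = inj₁ (stable-suc k st)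
    ... | inj₂ large with all-or-any (λ u → layer (suc k) u ∧ not (layer k u))
    ...   | inj₂ (u , p) = let p₁ , p₂ = ∧-true p in
              inj₂ (≤-trans (s≤s large) (count-suc u (not-true p₂) p₁ (λ _ → step-stay (layer k))))
    ...   | inj₁ none = inj₁ (stable-suc k λ u p → old u p (none u))
      where
      old : ∀ u → layer (suc k) u ≡ true → layer (suc k) u ∧ not (layer k u) ≡ false → layer k u ≡ true
      old u p q with layer k u
      ... | true  = refl
      ... | false rewrite p = ≡-sym q

    -- If the layers are still growing at step n, the last one has n vertices, so it is everything
    -- and stable for that reason.
    comp-stable : Stable n
    comp-stable u p with stable-or-large n
    ... | inj₁ st    = st u p
    ... | inj₂ large = count-full (layer n) large u

  comp-refl : ∀ {v} → X v ≡ false → comp G X v v ≡ true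
  comp-refl {v} p = layer-mono v {0} {n} {v} z≤n (∧-intro (≡ᵇ-refl {toℕ v} refl) (cong not p))

  comp-closed : ∀ {v u w} → comp G X v u ≡ true → adj G u w ≡ true → X w ≡ false → comp G X v w ≡ true
  comp-closed {v} p q r = comp-stable v _ (step-move (layer v n) p q r)

  -- Induction along walks in G - X. With `comp-refl` and `comp-closed` it characterises components;
  -- after this only breadth-first search looks at the layers themselves.
  comp-ind : (P : Fin n → Set) → ∀ {v} → (X v ≡ false → P v) →
    (∀ {u w} → P u → adj G u w ≡ true → X w ≡ false → P w) →
    ∀ {u} → comp G X v u ≡ true → P u
  comp-ind P {v} base closed {u} = go n u
    where
    go : ∀ k u → layer v k u ≡ true → P u
    go zero u p with layer-zero v {u} p
    ... | refl , v∉X = base v∉X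
    go (suc k) u p with step-elim (layer v k) {u} p
    ... | inj₁ q = go k u q
    ... | inj₂ (u∉X , w , q , e) = closed (go k w q) e u∉X

  comp-∉ : ∀ {v u} → comp G X v u ≡ true → X u ≡ false
  comp-∉ = comp-ind (λ u → X u ≡ false) (λ p → p) (λ _ _ p → p)

  comp-trans : ∀ {v u w} → comp G X v u ≡ true → comp G X u w ≡ true → comp G X v w ≡ true
  comp-trans p = comp-ind (λ w → comp G X _ w ≡ true) (λ _ → p) comp-closed

  comp-sym : ∀ {v u} → comp G X v u ≡ true → comp G X u v ≡ true
  -- Walking back from `w` enters `u` again, so the induction also has to carry that `u` lies
  -- outside X.
  comp-sym {v} p = proj₂ (comp-ind (λ u → X u ≡ false × comp G X u v ≡ true)
    (λ q → q , comp-refl q)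
    (λ { {u} {w} (u∉X , q) e w∉X → w∉X ,
         comp-trans (comp-closed (comp-refl w∉X) (trans (sym G w u) e) u∉X) q }) p)

  -- ω counts least vertices; any other choice of representatives gives the same count.
  ω≡count : (rep : Fin n → Fin n) (isRep : Fin n → Bool) →
    (∀ v → X v ≡ false → comp G X v (rep v) ≡ true) →
    (∀ v → X v ≡ false → isRep (rep v) ≡ true) →
    (∀ v → isRep v ≡ true → X v ≡ false × rep v ≡ v) →
    (∀ {u v} → comp G X u v ≡ true → rep u ≡ rep v) →
    ω G X ≡ countFin isRep
  ω≡count rep isRep rep-in rep-is is-rep rep-cong = ≤-antisym
    (count-injection _ isRep rep (λ v p → rep-is v (least-∉ v p))
      (λ u v p q e → least-unique u v p q (same (least-∉ u p) (least-∉ v q) e)))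
    (count-injection isRep _ least (λ v p → least-is v (proj₁ (is-rep v p)))
      (λ u v p q e → rep-unique p q e))
    where
    isLeast : Fin n → Bool
    isLeast v = not (X v) ∧ not (anyFin (λ u → comp G X v u ∧ (toℕ u <ᵇ toℕ v)))
    least-∉ : ∀ v → isLeast v ≡ true → X v ≡ false
    least-∉ v p = not-true (proj₁ (∧-true p))
    least-≤ : ∀ v → isLeast v ≡ true → ∀ u → comp G X v u ≡ true → toℕ v ≤ toℕ u
    least-≤ v p u q = <ᵇ-false (¬-not λ lt →
      clash (anyFin-intro _ u (∧-intro q lt)) (not-true (proj₂ (∧-true {not (X v)} p))))
    least-unique : ∀ u v → isLeast u ≡ true → isLeast v ≡ true → comp G X u v ≡ true → u ≡ v
    least-unique u v p q r = Fin.toℕ-injective (≤-antisym (least-≤ u p v r) (least-≤ v q u (comp-sym r)))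
    same : ∀ {u v} → X u ≡ false → X v ≡ false → rep u ≡ rep v → comp G X u v ≡ true
    same {u} {v} p q e = comp-trans (rep-in u p) (comp-sym (subst (λ z → comp G X v z ≡ true) (≡-sym e) (rep-in v q)))
    find : ∀ v → Σ (Fin n) λ u → X v ≡ false →
      comp G X v u ≡ true × (∀ w → comp G X v w ≡ true → toℕ u ≤ toℕ w)
    find v = search (X v) refl
      where
      search : ∀ b → X v ≡ b → Σ (Fin n) λ u → X v ≡ false →
        comp G X v u ≡ true × (∀ w → comp G X v w ≡ true → toℕ u ≤ toℕ w)
      -- For a vertex of X any value will do, as the guarantee is conditional on lying outside X;
      -- this keeps `least` a total function.
      search true  eq = v , λ p → clash eq p
      search false eq = let u , r = anyFin-least (comp G X v) (anyFin-intro _ v (comp-refl eq)) in u , λ _ → r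
    least : Fin n → Fin n
    least v = proj₁ (find v)
    least-in : ∀ v → X v ≡ false → comp G X v (least v) ≡ true
    least-in v p = proj₁ (proj₂ (find v) p)
    least-is : ∀ v → X v ≡ false → isLeast (least v) ≡ true
    least-is v p = ∧-intro (cong not (comp-∉ (least-in v p))) (cong not (¬-not (λ q →
      let u , r = anyFin-elim (λ u → comp G X (least v) u ∧ (toℕ u <ᵇ toℕ (least v))) q
          r₁ , r₂ = ∧-true r
      in <⇒≱ (<ᵇ-true r₂) (proj₂ (proj₂ (find v) p) u (comp-trans (least-in v p) r₁)))))
    rep-unique : ∀ {u v} → isRep u ≡ true → isRep v ≡ true → least u ≡ least v → u ≡ v
    rep-unique {u} {v} p q e with is-rep u p | is-rep v q
    ... | u∉ , ru | v∉ , rv = trans (≡-sym ru) (trans (rep-cong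
      (comp-trans (least-in u u∉) (comp-sym (subst (λ z → comp G X v z ≡ true) (≡-sym e) (least-in v v∉))))) rv)

  comp-card-≤τ : ∀ {v} → X v ≡ false → card (comp G X v) ≤ τ G X
  comp-card-≤τ {v} p = ≤-trans (case (X v) p) (≤-maxFin _ v)
    where
    case : ∀ b → b ≡ false → card (comp G X v) ≤ (if b then 0 else card (comp G X v))
    case false refl = ≤-refl

  τ-≤ : ∀ {c} → (∀ v → X v ≡ false → card (comp G X v) ≤ c) → τ G X ≤ c
  τ-≤ {c} h = maxFin-≤ _ λ v → case (X v) (h v)
    where
    case : ∀ b {s} → (b ≡ false → s ≤ c) → (if b then 0 else s) ≤ c
    case true  _ = z≤n
    case false p = p refl

  -- It is the complement of X that is independent: X is a vertex cover.
  Independent : Set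
  Independent = ∀ {u v} → X u ≡ false → X v ≡ false → adj G u v ≡ true → ⊥

  independent⇒τ≤1 : Independent → τ G X ≤ 1
  independent⇒τ≤1 ind = τ-≤ λ v v∉ → count-unique _ λ i j p q → trans (≡-sym (single v∉ p)) (single v∉ q)
    where
    single : ∀ {v u} → X v ≡ false → comp G X v u ≡ true → v ≡ u
    single {v} v∉ = comp-ind (v ≡_) (λ _ → refl) (λ { refl e w∉ → ⊥-elim (ind v∉ w∉ e) })

  τ≤1⇒independent : τ G X ≤ 1 → Independent
  τ≤1⇒independent small {u} {v} u∉ v∉ e = <⇒≱
    (count-two (comp G X u) (λ { refl → clash e (irrefl G u) }) (comp-refl u∉) (comp-closed (comp-refl u∉) e v∉))
    (≤-trans (comp-card-≤τ u∉) small)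

  τ≥1 : ∀ {v} → X v ≡ false → 1 ≤ τ G X
  τ≥1 {v} v∉ = ≤-trans (≤-trans (s≤s z≤n) (count-∖ (comp G X v) v (comp-refl v∉))) (comp-card-≤τ v∉)

  -- G - X has maximum degree at most 1.
  Matching : Set
  Matching = ∀ {v u w} → X v ≡ false → X u ≡ false → X w ≡ false →
    adj G v u ≡ true → adj G v w ≡ true → u ≡ w

  -- A walk from `v` to its only neighbour outside X can only turn back, since `v` is in turn the
  -- only such neighbour of that vertex.
  matching⇒τ≤2 : Matching → τ G X ≤ 2
  matching⇒τ≤2 match = τ-≤ λ v v∉ → ≤-trans (count-≤-∖ (comp G X v) v) (s≤s (others v∉))
    where
    near : ∀ {v} → X v ≡ false → ∀ {u} → comp G X v u ≡ true → v ≡ u ⊎ (adj G v u ≡ true × X u ≡ false)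
    near {v} v∉ = comp-ind (λ u → v ≡ u ⊎ (adj G v u ≡ true × X u ≡ false)) (λ _ → inj₁ refl)
      λ { (inj₁ refl) e w∉ → inj₂ (e , w∉)
        ; {u} {w} (inj₂ (e′ , u∉)) e w∉ → inj₁ (match u∉ v∉ w∉ (trans (sym G u v) e′) e) }
    others : ∀ {v} → X v ≡ false → countFin (comp G X v ∖ v) ≤ 1
    others {v} v∉ = count-unique _ λ i j p q → same i j (∧-true p) (∧-true q)
      where
      same : ∀ i j → comp G X v i ≡ true × not (v == i) ≡ true →
        comp G X v j ≡ true × not (v == j) ≡ true → i ≡ j
      same i j (p , p′) (q , q′) with near v∉ p | near v∉ q
      ... | inj₁ refl     | _               = clash (==-refl v) (not-true p′)
      ... | inj₂ _        | inj₁ refl       = clash (==-refl v) (not-true q′)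
      ... | inj₂ (e , i∉) | inj₂ (e′ , j∉) = match v∉ i∉ j∉ e e′

-- Rooted trees

handshake : (G : Graph n) → sumFin (deg G) ≡ edgeCount G + edgeCount G
handshake {n} G = begin
  sumFin (deg G)
    ≡⟨ sum-cong (λ u → trans (count≡sum (adj G u)) (trans (sum-cong (split u)) (sum-+ (up u) (λ v → up v u)))) ⟩
  sumFin (λ u → sumFin (up u) + sumFin (λ v → up v u))
    ≡⟨ sum-+ (λ u → sumFin (up u)) (λ u → sumFin (λ v → up v u)) ⟩
  sumFin (λ u → sumFin (up u)) + sumFin (λ u → sumFin (λ v → up v u))
    ≡⟨ cong (sumFin (λ u → sumFin (up u)) +_) (sum-swap up) ⟨
  sumFin (λ u → sumFin (up u)) + sumFin (λ u → sumFin (up u))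
    ≡⟨ cong₂ _+_ edges edges ⟨
  edgeCount G + edgeCount G ∎
  where
  open ≡-Reasoning
  up : Fin n → Fin n → ℕ
  up u v = ⟦ (toℕ u <ᵇ toℕ v) ∧ adj G u v ⟧
  edges : edgeCount G ≡ sumFin (λ u → sumFin (up u))
  edges = sum-cong λ u → count≡sum (λ v → (toℕ u <ᵇ toℕ v) ∧ adj G u v)
  split : ∀ u v → ⟦ adj G u v ⟧ ≡ up u v + up v u
  split u v with <-cmp (toℕ u) (toℕ v)
  ... | tri< lt _ gt rewrite <ᵇ-intro lt | ¬-not (λ p → gt (<ᵇ-true {toℕ v} {toℕ u} p)) = ≡-sym (+-identityʳ _)
  ... | tri> lt _ gt rewrite <ᵇ-intro gt | ¬-not (λ p → lt (<ᵇ-true {toℕ u} {toℕ v} p)) = cong ⟦_⟧ (sym G u v)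
  ... | tri≈ _ eq _ with Fin.toℕ-injective eq
  ...   | refl rewrite irrefl G u | ∧-zeroʳ (toℕ u <ᵇ toℕ u) = refl

-- The value of `par` at the root is arbitrary. The fields describe a spanning tree by its parent
-- edges; that G has no other edges is the separate property `TreeEdges`.
record Rooted (G : Graph n) : Set where
  field
    root        : Fin n
    par         : Fin n → Fin n
    dep         : Fin n → ℕ
    dep-root    : dep root ≡ 0
    root-unique : ∀ {v} → dep v ≡ 0 → v ≡ root
    dep-par     : ∀ {v k} → dep v ≡ suc k → dep (par v) ≡ k
    adj-par     : ∀ {v k} → dep v ≡ suc k → adj G v (par v) ≡ true

  nonroot : Fin n → Bool
  nonroot v = 0 <ᵇ dep v

  nonroot-true : ∀ {v} → nonroot v ≡ true → ∃ λ k → dep v ≡ suc k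
  nonroot-true {v} p with dep v
  ... | suc k = k , refl

  nonroot-suc : ∀ {v k} → dep v ≡ suc k → nonroot v ≡ true
  nonroot-suc p rewrite p = refl

  root-false : ∀ v → not (nonroot v) ≡ (root == v)
  root-false v with dep v in eq
  ... | zero rewrite root-unique eq = ≡-sym (==-refl root)
  ... | suc k = ≡-sym (≢⇒== {i = root} {v} λ { refl → 1+n≢0 (trans (≡-sym eq) dep-root) })

  one-root : sumFin (λ v → ⟦ not (nonroot v) ⟧) ≡ 1
  one-root = trans (sum-cong (λ v → cong ⟦_⟧ (root-false v))) (count-== root)

  below : Fin n → Fin n → ℕ
  below u v = ⟦ nonroot u ∧ (par u == v) ⟧

  below-true : ∀ {u v} → nonroot u ∧ (par u == v) ≡ true → dep u ≡ suc (dep v) × par u ≡ v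
  below-true {u} {v} p with ∧-true {nonroot u} p
  ... | q , r with nonroot-true {u} q | ==⇒≡ {i = par u} {v} r
  ...   | k , e | refl = trans e (cong suc (≡-sym (dep-par e))) , refl

  -- The two summands are never both 1, since depths differ in opposite directions.
  below-≤-adj : ∀ u v → below u v + below v u ≤ ⟦ adj G u v ⟧
  below-≤-adj u v with nonroot u ∧ (par u == v) in p | nonroot v ∧ (par v == u) in q
  ... | false | false = z≤n
  ... | true  | true  = ⊥-elim (<-irrefl (proj₁ (below-true {u} {v} p))
      (≤-trans (n≤1+n _) (≤-reflexive (cong suc (≡-sym (proj₁ (below-true {v} {u} q)))))))
  ... | true  | false with below-true {u} {v} p
  ...   | e , refl rewrite adj-par e = ≤-refl
  below-≤-adj u v | false | true with below-true {v} {u} q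
  ...   | e , refl rewrite sym G (par v) v | adj-par e = ≤-refl

  sum-below : ∀ u → sumFin (below u) ≡ ⟦ nonroot u ⟧
  sum-below u = trans (sum-cong λ v → swap (nonroot u) (par u == v)) (sum-pick (par u) (λ _ → ⟦ nonroot u ⟧))
    where
    swap : ∀ a b → ⟦ a ∧ b ⟧ ≡ (if b then ⟦ a ⟧ else 0)
    swap true  true  = refl
    swap true  false = refl
    swap false true  = refl
    swap false false = refl

  count-nonroot : suc (sumFin (λ v → ⟦ nonroot v ⟧)) ≡ n
  count-nonroot = begin
    1 + sumFin (λ v → ⟦ nonroot v ⟧)
      ≡⟨ +-comm 1 _ ⟩
    sumFin (λ v → ⟦ nonroot v ⟧) + 1
      ≡⟨ cong₂ _+_ (count≡sum nonroot) (trans (count≡sum (λ v → not (nonroot v))) one-root) ⟨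
    countFin nonroot + countFin (λ v → not (nonroot v))
      ≡⟨ count-not nonroot ⟩
    n ∎
    where open ≡-Reasoning

  -- Each of the n - 1 nonroot vertices has one parent edge, seen once from either end.
  sum-sum-below : sumFin (λ u → sumFin (λ v → below u v + below v u)) ≡ (n ∸ 1) + (n ∸ 1)
  sum-sum-below = begin
    sumFin (λ u → sumFin (λ v → below u v + below v u))
      ≡⟨ sum-cong (λ u → sum-+ (below u) (λ v → below v u)) ⟩
    sumFin (λ u → sumFin (below u) + sumFin (λ v → below v u))
      ≡⟨ sum-+ (λ u → sumFin (below u)) (λ u → sumFin (λ v → below v u)) ⟩
    sumFin (λ u → sumFin (below u)) + sumFin (λ u → sumFin (λ v → below v u))
      ≡⟨ cong (sumFin (λ u → sumFin (below u)) +_) (sum-swap below) ⟨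
    sumFin (λ u → sumFin (below u)) + sumFin (λ u → sumFin (below u))
      ≡⟨ cong₂ _+_ half half ⟩
    (n ∸ 1) + (n ∸ 1) ∎
    where
    open ≡-Reasoning
    half : sumFin (λ u → sumFin (below u)) ≡ n ∸ 1
    half = trans (sum-cong sum-below) (cong (_∸ 1) count-nonroot)

  connected : Connected G
  connected u v = comp-trans (to-root (dep u) u refl) (comp-sym (to-root (dep v) v refl))
    where
    open Component G emptySet
    to-root : ∀ k v → dep v ≡ k → comp G emptySet v root ≡ true
    to-root zero    v e rewrite root-unique e = comp-refl {root} refl
    to-root (suc k) v e = comp-trans {v} {par v} {root} (comp-closed {v} {v} (comp-refl {v} refl) (adj-par e) refl) (to-root k (par v) (dep-par e))

  TreeEdges : Set
  TreeEdges = ∀ u v → adj G u v ≡ true →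
    (dep u ≡ suc (dep v) × par u ≡ v) ⊎ (dep v ≡ suc (dep u) × par v ≡ u)

  adj-split : TreeEdges → ∀ u v → ⟦ adj G u v ⟧ ≡ below u v + below v u
  adj-split edges u v = ≤-antisym upper (below-≤-adj u v)
    where
    upper : ⟦ adj G u v ⟧ ≤ below u v + below v u
    upper with adj G u v in eq
    ... | false = z≤n
    ... | true with edges u v eq
    ...   | inj₁ (e , refl) rewrite nonroot-suc e | ==-refl (par u) = s≤s z≤n
    ...   | inj₂ (e , refl) rewrite nonroot-suc e | ==-refl (par v) = m≤n+m 1 (below (par v) v)

  -- Serves to recognise the path graph as a tree, rooted at its first vertex; the degree sum equals
  -- twice the number of parent edges.
  treeEdges⇒isTree : TreeEdges → IsTree G
  treeEdges⇒isTree edges = connected , double-injective (begin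
    edgeCount G + edgeCount G
      ≡⟨ handshake G ⟨
    sumFin (deg G)
      ≡⟨ sum-cong (λ u → trans (count≡sum (adj G u)) (sum-cong (adj-split edges u))) ⟩
    sumFin (λ u → sumFin (λ v → below u v + below v u))
      ≡⟨ sum-sum-below ⟩
    (n ∸ 1) + (n ∸ 1) ∎)
    where
    open ≡-Reasoning
    double-injective : ∀ {a b} → a + a ≡ b + b → a ≡ b
    double-injective {a} {b} e with <-cmp a b
    ... | tri< lt _ _ = ⊥-elim (<-irrefl e (+-mono-< lt lt))
    ... | tri≈ _ eq _ = eq
    ... | tri> _ _ gt = ⊥-elim (<-irrefl (≡-sym e) (+-mono-< gt gt))

  -- The parent edges already exhaust the edge count.
  isTree⇒treeEdges : IsTree G → TreeEdges
  isTree⇒treeEdges (_ , edges) u v p with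
      nonroot u ∧ (par u == v) in q | nonroot v ∧ (par v == u) in r | sum-tight (below-≤-adj u) row v
    where
    total : sumFin (λ u → sumFin (λ v → ⟦ adj G u v ⟧)) ≡ sumFin (λ u → sumFin (λ v → below u v + below v u))
    total = begin
      sumFin (λ u → sumFin (λ v → ⟦ adj G u v ⟧)) ≡⟨ sum-cong (λ u → count≡sum (adj G u)) ⟨
      sumFin (deg G)                               ≡⟨ handshake G ⟩
      edgeCount G + edgeCount G                    ≡⟨ cong₂ _+_ edges edges ⟩
      (n ∸ 1) + (n ∸ 1)                            ≡⟨ sum-sum-below ⟨
      sumFin (λ u → sumFin (λ v → below u v + below v u)) ∎
      where open ≡-Reasoning
    row : sumFin (λ v → ⟦ adj G u v ⟧) ≤ sumFin (λ v → below u v + below v u)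
    row = ≤-reflexive (≡-sym (sum-tight (λ u → sum-mono (below-≤-adj u)) (≤-reflexive total) u))
  ... | true  | _     | _ = inj₁ (below-true {u} {v} q)
  ... | false | true  | _ = inj₂ (below-true {v} {u} r)
  ... | false | false | e rewrite p = ⊥-elim (1+n≢0 (≡-sym e))

-- Breadth-first search: the depth is the first layer reaching a vertex.
rootAt : (G : Graph n) → Connected G → (r : Fin n) → Σ (Rooted G) λ R → Rooted.root R ≡ r
rootAt {n} G conn r = record
  { root = r ; par = λ v → proj₁ (parent v) ; dep = depth
  ; dep-root = n≤0⇒n≡0 (depth-min 0 r (∧-intro {toℕ r ≡ᵇ toℕ r} (≡ᵇ-refl {toℕ r} refl) refl))
  ; root-unique = λ {v} e → proj₁ (layer-zero r {v} (subst (λ k → layer r k v ≡ true) e (depth-in v)))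
  ; dep-par = λ {v} e → proj₁ (proj₂ (parent v) e)
  ; adj-par = λ {v} e → proj₂ (proj₂ (parent v) e) } , refl
  where
  open Component G emptySet
  first : ∀ k v → layer r k v ≡ true →
    ∃ λ j → layer r j v ≡ true × (∀ i → j ≡ suc i → layer r i v ≡ false)
  first zero    v p = 0 , p , λ _ ()
  first (suc k) v p = search (layer r k v) refl
    where
    search : ∀ b → layer r k v ≡ b → ∃ λ j → layer r j v ≡ true × (∀ i → j ≡ suc i → layer r i v ≡ false)
    search true  eq = first k v eq
    search false eq = suc k , p , λ { _ refl → eq }
  depth : Fin n → ℕ
  depth v = proj₁ (first n v (conn r v))
  depth-in : ∀ v → layer r (depth v) v ≡ true
  depth-in v = proj₁ (proj₂ (first n v (conn r v)))
  depth-first : ∀ v i → depth v ≡ suc i → layer r i v ≡ false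
  depth-first v = proj₂ (proj₂ (first n v (conn r v)))
  depth-min : ∀ k v → layer r k v ≡ true → depth v ≤ k
  depth-min k v p = ≮⇒≥ λ lt → late (depth v) refl lt
    where
    late : ∀ d → depth v ≡ d → k < d → ⊥
    late (suc i) e (s≤s k≤i) = clash (layer-mono r {k} {i} {v} k≤i p) (depth-first v i e)
  climb : ∀ v k → depth v ≡ suc k → ∃ λ w → depth w ≡ k × adj G v w ≡ true
  climb v k e with step-elim (layer r k) {v} (subst (λ d → layer r d v ≡ true) e (depth-in v))
  ... | inj₁ p = clash p (depth-first v k e)
  ... | inj₂ (_ , w , p , a) = w , ≤-antisym (depth-min k w p) (≮⇒≥ early) , trans (sym G v w) a
    where
    early : ¬ depth w < k
    early lt = clash (layer-mono r {suc (depth w)} {k} {v} lt (step-move (layer r (depth w)) {v} {w} (depth-in w) a refl)) (depth-first v k e)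
  parent : ∀ v → ∃ λ w → ∀ {k} → depth v ≡ suc k → depth w ≡ k × adj G v w ≡ true
  parent v = search (depth v) refl
    where
    search : ∀ d → depth v ≡ d → ∃ λ w → ∀ {k} → depth v ≡ suc k → depth w ≡ k × adj G v w ≡ true
    search zero    e = v , λ e′ → ⊥-elim (1+n≢0 (trans (≡-sym e′) e))
    search (suc k) e = let w , p , a = climb v k e in
      w , λ e′ → trans p (suc-injective (trans (≡-sym e) e′)) , a

even : ℕ → Bool
even zero    = true
even (suc k) = not (even k)

not-self : ∀ {b} → b ≡ not b → ⊥
not-self {true} ()
not-self {false} ()

-- Counting the components of G - X in a rooted tree

module Tree {G : Graph n} (R : Rooted G) (edges : Rooted.TreeEdges R) where
  open Rooted R

  deg-split : ∀ x → deg G x ≡ ⟦ nonroot x ⟧ + sumFin (λ v → below v x)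
  deg-split x = trans (count≡sum (adj G x)) (trans (sum-cong (adj-split edges x))
    (trans (sum-+ (below x) (λ v → below v x)) (cong (_+ sumFin (λ v → below v x)) (sum-below x))))

  module Cut (X : VSet n) where
    open Component G X

    inner : Fin n → Bool
    inner v = nonroot v ∧ X (par v)

    isTop : Fin n → Bool
    isTop v = not (X v) ∧ (not (nonroot v) ∨ X (par v))

    -- Climbs until the parent lies in X. The fuel is the depth, so it runs out exactly at the root.
    topFrom : ℕ → Fin n → Fin n
    topFrom zero    v = v
    topFrom (suc k) v = if X (par v) then v else topFrom k (par v)

    top : Fin n → Fin n
    top v = topFrom (dep v) v

    topFrom-comp : ∀ k v → dep v ≡ k → X v ≡ false → comp G X v (topFrom k v) ≡ true
    topFrom-comp zero    v e v∉ = comp-refl v∉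
    topFrom-comp (suc k) v e v∉ = go (X (par v)) refl
      where
      go : ∀ b → X (par v) ≡ b → comp G X v (if b then v else topFrom k (par v)) ≡ true
      go true  _  = comp-refl v∉
      go false p∉ = comp-trans (comp-closed (comp-refl v∉) (adj-par e) p∉) (topFrom-comp k (par v) (dep-par e) p∉)

    topFrom-isTop : ∀ k v → dep v ≡ k → X v ≡ false → isTop (topFrom k v) ≡ true
    topFrom-isTop zero    v e v∉ rewrite v∉ | e = refl
    topFrom-isTop (suc k) v e v∉ = go (X (par v)) refl
      where
      go : ∀ b → X (par v) ≡ b → isTop (if b then v else topFrom k (par v)) ≡ true
      go true  p∈ rewrite v∉ | p∈ = ∨-zeroʳ _
      go false p∉ = topFrom-isTop k (par v) (dep-par e) p∉

    isTop-top : ∀ v → isTop v ≡ true → X v ≡ false × top v ≡ v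
    isTop-top v p with ∧-true {not (X v)} p
    ... | v∉ , q = not-true v∉ , fixed (dep v) refl (∨-true {not (nonroot v)} q)
      where
      fixed : ∀ d → dep v ≡ d → not (nonroot v) ≡ true ⊎ X (par v) ≡ true → topFrom d v ≡ v
      fixed zero    e _        = refl
      fixed (suc k) e (inj₁ r) = clash (nonroot-suc e) (not-true r)
      fixed (suc k) e (inj₂ r) rewrite r = refl

    top-child : ∀ {v} → dep v ≡ suc (dep (par v)) → X (par v) ≡ false → top v ≡ top (par v)
    top-child e p∉ rewrite e | p∉ = refl

    top-cong : ∀ {u v} → comp G X u v ≡ true → top u ≡ top v
    top-cong {u} p = proj₂ (comp-ind (λ w → X w ≡ false × top u ≡ top w) (λ q → q , refl) closed p)
      where
      closed : ∀ {v w} → X v ≡ false × top u ≡ top v → adj G v w ≡ true → X w ≡ false → X w ≡ false × top u ≡ top w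
      closed {v} {w} (v∉ , q) a w∉ with edges v w a
      ... | inj₁ (e , refl) = w∉ , trans q (top-child e w∉)
      ... | inj₂ (e , refl) = w∉ , trans q (≡-sym (top-child e v∉))

    ω≡tops : ω G X ≡ countFin isTop
    ω≡tops = ω≡count top isTop
      (λ v → topFrom-comp (dep v) v refl) (λ v → topFrom-isTop (dep v) v refl) isTop-top top-cong

    -- A nonroot vertex outside X has its parent in X, since otherwise their edge would avoid X.
    -- Hence every remaining vertex is the top of its own component.
    independent⇒ω : Independent → card X + ω G X ≡ n
    independent⇒ω ind = trans (cong (card X +_) (trans ω≡tops (count-cong every))) (count-not X)
      where
      every : ∀ v → isTop v ≡ not (X v)
      every v with X v in v∉
      ... | true  = refl
      ... | false with dep v in e
      ...   | zero  = refl
      ...   | suc k = ¬-not λ q → ind v∉ q (adj-par e)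

    innerSum degSum : ℕ
    innerSum = sumFin (λ v → ⟦ X v ∧ inner v ⟧)
    degSum   = sumFin (λ v → if X v then deg G v else 0)

    -- The degree of `x` is its number of children, plus one if it has a parent. Summed over X, the
    -- children are regrouped by the child: one is counted exactly when its parent is in X.
    degSum-split : degSum ≡ sumFin (λ v → ⟦ X v ∧ nonroot v ⟧) + sumFin (λ v → ⟦ inner v ⟧)
    degSum-split = begin
      degSum
        ≡⟨ sum-cong (λ x → expand x (X x)) ⟩
      sumFin (λ x → ⟦ X x ∧ nonroot x ⟧ + sumFin (λ v → if X x then below v x else 0))
        ≡⟨ sum-+ (λ x → ⟦ X x ∧ nonroot x ⟧) (λ x → sumFin (λ v → if X x then below v x else 0)) ⟩
      sumFin (λ x → ⟦ X x ∧ nonroot x ⟧) + sumFin (λ x → sumFin (λ v → if X x then below v x else 0))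
        ≡⟨ cong (sumFin (λ x → ⟦ X x ∧ nonroot x ⟧) +_) (trans (sum-swap (λ x v → if X x then below v x else 0)) (sum-cong children)) ⟩
      sumFin (λ v → ⟦ X v ∧ nonroot v ⟧) + sumFin (λ v → ⟦ inner v ⟧) ∎
      where
      open ≡-Reasoning
      expand : ∀ x b → (if b then deg G x else 0) ≡ ⟦ b ∧ nonroot x ⟧ + sumFin (λ v → if b then below v x else 0)
      expand x true  = deg-split x
      expand x false = ≡-sym (sum-zero n)
      shuffle : ∀ a b c → (if c then ⟦ a ∧ b ⟧ else 0) ≡ (if b then ⟦ a ∧ c ⟧ else 0)
      shuffle true  true  true  = refl
      shuffle true  true  false = refl
      shuffle true  false true  = refl
      shuffle true  false false = refl
      shuffle false true  true  = refl
      shuffle false true  false = refl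
      shuffle false false true  = refl
      shuffle false false false = refl
      children : ∀ v → sumFin (λ x → if X x then below v x else 0) ≡ ⟦ inner v ⟧
      children v = trans (sum-cong λ x → shuffle (nonroot v) (par v == x) (X x))
                         (sum-pick (par v) (λ x → ⟦ nonroot v ∧ X x ⟧))

    -- Once `degSum` is split, both sides are sums over vertices that agree term by term: `local`
    -- checks the eight cases of `v` in X, `v` nonroot, parent of `v` in X. The 1 on the right is
    -- the contribution of the root.
    ω-formula : ω G X + card X + innerSum ≡ suc degSum
    ω-formula = begin
      ω G X + card X + innerSum
        ≡⟨ cong (_+ innerSum) (cong₂ _+_ (trans ω≡tops (count≡sum isTop)) (count≡sum X)) ⟩
      sumFin (λ v → ⟦ isTop v ⟧) + sumFin (λ v → ⟦ X v ⟧) + innerSum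
        ≡⟨ trans (sum-+ (λ v → ⟦ isTop v ⟧ + ⟦ X v ⟧) (λ v → ⟦ X v ∧ inner v ⟧)) (cong (_+ innerSum) (sum-+ (λ v → ⟦ isTop v ⟧) (λ v → ⟦ X v ⟧))) ⟨
      sumFin (λ v → ⟦ isTop v ⟧ + ⟦ X v ⟧ + ⟦ X v ∧ inner v ⟧)
        ≡⟨ sum-cong (λ v → local (X v) (nonroot v) (X (par v))) ⟩
      sumFin (λ v → ⟦ not (nonroot v) ⟧ + (⟦ X v ∧ nonroot v ⟧ + ⟦ inner v ⟧))
        ≡⟨ trans (sum-+ (λ v → ⟦ not (nonroot v) ⟧) (λ v → ⟦ X v ∧ nonroot v ⟧ + ⟦ inner v ⟧)) (cong₂ _+_ one-root (sum-+ (λ v → ⟦ X v ∧ nonroot v ⟧) (λ v → ⟦ inner v ⟧))) ⟩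
      suc (sumFin (λ v → ⟦ X v ∧ nonroot v ⟧) + sumFin (λ v → ⟦ inner v ⟧))
        ≡⟨ cong suc degSum-split ⟨
      suc degSum ∎
      where
      open ≡-Reasoning
      local : ∀ x r p → ⟦ not x ∧ (not r ∨ p) ⟧ + ⟦ x ⟧ + ⟦ x ∧ (r ∧ p) ⟧ ≡ ⟦ not r ⟧ + (⟦ x ∧ r ⟧ + ⟦ r ∧ p ⟧)
      local true  true  true  = refl
      local true  true  false = refl
      local true  false true  = refl
      local true  false false = refl
      local false true  true  = refl
      local false true  false = refl
      local false false true  = refl
      local false false false = refl

    -- Here `b v` plays the part of deg v - 2 - [parent of v in X], whose sum over X is ω - |X| - 1
    -- by `ω-formula`. The bounds `ω-≥` and `ω-≤` are stated additively to stay clear of truncated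
    -- subtraction.
    surplus : (Fin n → ℕ) → ℕ
    surplus b = sumFin (λ v → if X v then b v else 0)

    surplus-expand : ∀ b → surplus (λ v → 2 + ⟦ inner v ⟧ + b v) ≡ card X + card X + innerSum + surplus b
    surplus-expand b = begin
      surplus (λ v → 2 + ⟦ inner v ⟧ + b v)
        ≡⟨ sum-cong (λ v → local (X v) (inner v) (b v)) ⟩
      sumFin (λ v → ⟦ X v ⟧ + ⟦ X v ⟧ + ⟦ X v ∧ inner v ⟧ + (if X v then b v else 0))
        ≡⟨ sum-+ (λ v → ⟦ X v ⟧ + ⟦ X v ⟧ + ⟦ X v ∧ inner v ⟧) (λ v → if X v then b v else 0) ⟩
      sumFin (λ v → ⟦ X v ⟧ + ⟦ X v ⟧ + ⟦ X v ∧ inner v ⟧) + surplus b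
        ≡⟨ cong (_+ surplus b) (sum-+ (λ v → ⟦ X v ⟧ + ⟦ X v ⟧) (λ v → ⟦ X v ∧ inner v ⟧)) ⟩
      sumFin (λ v → ⟦ X v ⟧ + ⟦ X v ⟧) + innerSum + surplus b
        ≡⟨ cong (λ z → z + innerSum + surplus b) (trans (sum-+ (λ v → ⟦ X v ⟧) (λ v → ⟦ X v ⟧)) (≡-sym (cong₂ _+_ (count≡sum X) (count≡sum X)))) ⟩
      card X + card X + innerSum + surplus b ∎
      where
      open ≡-Reasoning
      local : ∀ x i c → (if x then 2 + ⟦ i ⟧ + c else 0) ≡ ⟦ x ⟧ + ⟦ x ⟧ + ⟦ x ∧ i ⟧ + (if x then c else 0)
      local true  i c = refl
      local false i c = refl

    surplus-suc : ∀ b → suc (surplus (λ v → 2 + ⟦ inner v ⟧ + b v)) ≡ (suc (card X) + surplus b) + (card X + innerSum)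
    surplus-suc b = trans (cong suc (surplus-expand b))
      (solve 3 (λ c i s → con 1 :+ (c :+ c :+ i :+ s) := (con 1 :+ c :+ s) :+ (c :+ i)) refl (card X) innerSum (surplus b))
      where open +-*-Solver

    ω-formula′ : suc degSum ≡ ω G X + (card X + innerSum)
    ω-formula′ = trans (≡-sym ω-formula) (+-assoc (ω G X) (card X) innerSum)

    private
      if-≤ : ∀ x {a b} → (x ≡ true → a ≤ b) → (if x then a else 0) ≤ (if x then b else 0)
      if-≤ true  p = p refl
      if-≤ false p = z≤n

    ω-≥ : ∀ b → (∀ v → X v ≡ true → 2 + ⟦ inner v ⟧ + b v ≤ deg G v) → suc (card X) + surplus b ≤ ω G X
    ω-≥ b h = +-cancelʳ-≤ (card X + innerSum) _ _ (begin
      (suc (card X) + surplus b) + (card X + innerSum) ≡⟨ surplus-suc b ⟨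
      suc (surplus (λ v → 2 + ⟦ inner v ⟧ + b v))      ≤⟨ s≤s (sum-mono λ v → if-≤ (X v) (h v)) ⟩
      suc degSum                                       ≡⟨ ω-formula′ ⟩
      ω G X + (card X + innerSum)                      ∎)
      where open ≤-Reasoning

    ω-≤ : ∀ b → (∀ v → X v ≡ true → deg G v ≤ 2 + ⟦ inner v ⟧ + b v) → ω G X ≤ suc (card X) + surplus b
    ω-≤ b h = +-cancelʳ-≤ (card X + innerSum) _ _ (begin
      ω G X + (card X + innerSum)                      ≡⟨ ω-formula′ ⟨
      suc degSum                                       ≤⟨ s≤s (sum-mono λ v → if-≤ (X v) (h v)) ⟩
      suc (surplus (λ v → 2 + ⟦ inner v ⟧ + b v))      ≡⟨ surplus-suc b ⟩
      (suc (card X) + surplus b) + (card X + innerSum) ∎)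
      where open ≤-Reasoning

    surplus-zero : surplus (λ _ → 0) ≡ 0
    surplus-zero = trans (sum-cong λ v → zero-if (X v)) (sum-zero n)
      where
      zero-if : ∀ b → (if b then 0 else 0) ≡ 0
      zero-if true  = refl
      zero-if false = refl

    surplus-at : ∀ {v} → X v ≡ true → ∀ c → surplus (λ u → if v == u then c else 0) ≡ c
    surplus-at {v} v∈ c = trans (sum-cong λ u → commute (v == u) (X u)) (trans (sum-pick v (λ u → if X u then c else 0)) collapse)
      where
      commute : ∀ a b → (if b then (if a then c else 0) else 0) ≡ (if a then (if b then c else 0) else 0)
      commute true  true  = refl
      commute true  false = refl
      commute false true  = refl
      commute false false = refl
      collapse : (if X v then c else 0) ≡ c
      collapse rewrite v∈ = refl

    surplus-+ : ∀ b c → surplus (λ v → b v + c v) ≡ surplus b + surplus c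
    surplus-+ b c = trans (sum-cong λ v → distr (X v)) (sum-+ (λ v → if X v then b v else 0) (λ v → if X v then c v else 0))
      where
      distr : ∀ x {p q} → (if x then p + q else 0) ≡ (if x then p else 0) + (if x then q else 0)
      distr true  = refl
      distr false = refl

  even-independent : Component.Independent G (λ v → even (dep v))
  even-independent {u} {v} p q a with edges u v a
  ... | inj₁ (e , _) rewrite e = not-self (trans q (≡-sym p))
  ... | inj₂ (e , _) rewrite e = not-self (trans p (≡-sym q))

  odd-independent : Component.Independent G (λ v → not (even (dep v)))
  odd-independent {u} {v} p q a with edges u v a
  ... | inj₁ (e , _) rewrite e = not-self (trans q (≡-sym p))
  ... | inj₂ (e , _) rewrite e = not-self (trans p (≡-sym q))

  small-class : ∃ λ X → card X + card X ≤ n × Component.Independent G X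
  small-class with ≤-total (card (λ v → even (dep v))) (card (λ v → not (even (dep v))))
  ... | inj₁ le = _ , ≤-trans (+-monoʳ-≤ _ le) (≤-reflexive (count-not (λ v → even (dep v)))) , even-independent
  ... | inj₂ le = _ , ≤-trans (+-monoˡ-≤ _ le) (≤-reflexive (count-not (λ v → even (dep v)))) , odd-independent

-- Cuts with components of order at most two

module _ (G : Graph n) where

  leafNeighbours : Fin n → ℕ
  leafNeighbours v = countFin (λ u → adj G v u ∧ (deg G u <ᵇ 2))

  leaf-neighbour : ∀ {v u} → adj G v u ≡ true → deg G u ≤ 1 → adj G v u ∧ (deg G u <ᵇ 2) ≡ true
  leaf-neighbour a l = ∧-intro a (<ᵇ-intro (s≤s l))

  nonleaf-neighbour : ∀ {v u} → 2 ≤ deg G u → adj G v u ∧ (deg G u <ᵇ 2) ≡ false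
  nonleaf-neighbour {v} {u} l = ¬-not λ p → <⇒≱ (<ᵇ-true (proj₂ (∧-true {adj G v u} p))) l

  leafNeighbours-≤ : ∀ {v} → leafNeighbours v ≤ deg G v
  leafNeighbours-≤ {v} = count-mono {f = λ u → adj G v u ∧ (deg G u <ᵇ 2)} λ i p → proj₁ (∧-true p)

  nonleaf⇒leafNeighbours< : ∀ {v a} → adj G v a ≡ true → 2 ≤ deg G a → suc (leafNeighbours v) ≤ deg G v
  nonleaf⇒leafNeighbours< {v} {a} p l =
    count-suc {f = λ u → adj G v u ∧ (deg G u <ᵇ 2)} a (nonleaf-neighbour {v} {a} l) p (λ j q → proj₁ (∧-true q))

  two-nonleaves⇒leafNeighbours< : ∀ {v a b} → a ≢ b → adj G v a ≡ true → adj G v b ≡ true →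
    2 ≤ deg G a → 2 ≤ deg G b → 2 + leafNeighbours v ≤ deg G v
  two-nonleaves⇒leafNeighbours< {v} {a} {b} ne pa pb la lb = ≤-trans
    (s≤s (count-suc {f = λ u → adj G v u ∧ (deg G u <ᵇ 2)} b (nonleaf-neighbour {v} {b} lb) (∖-≢ (adj G v) ne pb)
      (λ j q → ∖-≢ (adj G v) {a} {j} (λ { refl → clash q (nonleaf-neighbour {v} {a} la) }) (proj₁ (∧-true q)))))
    (count-∖ (adj G v) a pa)

  unique-neighbour : ∀ {v u w} → deg G v ≤ 1 → adj G v u ≡ true → adj G v w ≡ true → u ≡ w
  unique-neighbour {v} {u} {w} l p q with u Fin.≟ w
  ... | yes e = e
  ... | no ne = ⊥-elim (<⇒≱ (count-two (adj G v) ne p q) l)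

  unique-other-neighbour : ∀ {v a u w} → deg G v ≤ 2 → adj G v a ≡ true → a ≢ u → a ≢ w →
    adj G v u ≡ true → adj G v w ≡ true → u ≡ w
  unique-other-neighbour {v} {a} {u} {w} l pa au aw p q with u Fin.≟ w
  ... | yes e = e
  ... | no ne = ⊥-elim (<⇒≱ (count-three (adj G v) au aw ne pa p q) l)

  unique-leaf-neighbour : ∀ {v u w} → leafNeighbours v ≤ 1 → adj G v u ≡ true → adj G v w ≡ true →
    deg G u ≤ 1 → deg G w ≤ 1 → u ≡ w
  unique-leaf-neighbour {v} {u} {w} l p q lu lw with u Fin.≟ w
  ... | yes e = e
  ... | no ne = ⊥-elim (<⇒≱ (count-two (λ z → adj G v z ∧ (deg G z <ᵇ 2)) ne (leaf-neighbour p lu) (leaf-neighbour q lw)) l)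

  -- The ratio of such a cut is at most (|X| + 2)/(|X| + 1 + c): at most 1, hence below (n + 2)/n,
  -- for c = 1, and below 1 for c = 2.
  DeepCut : ℕ → Set
  DeepCut c = ∃ λ X → τ G X ≤ 2 × suc (card X) + c ≤ ω G X

-- Deep cuts from vertices of large degree

module Branching {G : Graph n} (R : Rooted G) (edges : Rooted.TreeEdges R) where
  open Rooted R
  open Tree R edges

  member-≢ : ∀ {X : VSet n} {u v} → X u ≡ true → X v ≡ false → u ≢ v
  member-≢ p q refl = clash p q

  root≢ : ∀ {v k} → dep v ≡ suc k → root ≢ v
  root≢ e refl = 1+n≢0 (trans (≡-sym e) dep-root)

  adj-parity : ∀ {u v} → adj G u v ≡ true → even (dep v) ≡ not (even (dep u))
  adj-parity {u} {v} a with edges u v a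
  ... | inj₁ (e , _) rewrite e = ≡-sym (not-involutive _)
  ... | inj₂ (e , _) rewrite e = refl

  -- A parent other than the root has its own parent and a child, two neighbours whose depths differ
  -- by 2.
  parent-nonleaf : ∀ {v k} → 2 ≤ deg G root → dep v ≡ suc k → 2 ≤ deg G (par v)
  parent-nonleaf {v} {zero} l e = subst (λ x → 2 ≤ deg G x) (≡-sym (root-unique (dep-par e))) l
  parent-nonleaf {v} {suc k} l e = count-two (adj G (par v)) grandparent≢ (adj-par (dep-par e)) (trans (sym G (par v) v) (adj-par e))
    where
    grandparent≢ : par (par v) ≢ v
    grandparent≢ q = m≢1+n+m k {1} (trans (≡-sym (dep-par (dep-par e))) (trans (cong dep q) e))

  module Greedy where
    -- A nonroot vertex is taken exactly when deg - 2 - [parent in X] is nonnegative. One left out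
    -- is a leaf, or has degree at most 2 and its parent in X; either way at most one neighbour
    -- remains to it.
    inside : ℕ → Fin n → Bool
    inside zero    v = true
    inside (suc k) v = if inside k (par v) then 2 <ᵇ deg G v else 1 <ᵇ deg G v

    X : VSet n
    X v = inside (dep v) v

    open Component G X
    open Cut X

    X-root : ∀ {v} → dep v ≡ 0 → X v ≡ true
    X-root e rewrite e = refl

    X-suc : ∀ {v k} → dep v ≡ suc k → X v ≡ (if X (par v) then 2 <ᵇ deg G v else 1 <ᵇ deg G v)
    X-suc e rewrite e | dep-par e = refl

    matching : Matching
    matching {v} {u} {w} v∉ u∉ w∉ a a′ = go (dep v) refl (X (par v)) refl
      where
      go : ∀ d → dep v ≡ d → ∀ b → X (par v) ≡ b → u ≡ w
      go zero    e _ _ = clash (X-root e) v∉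
      go (suc k) e true  p∈ = unique-other-neighbour G
        (<ᵇ-false (trans (≡-sym (trans (X-suc e) (cong (if_then _ else _) p∈))) v∉))
        (adj-par e) (member-≢ {X} p∈ u∉) (member-≢ {X} p∈ w∉) a a′
      go (suc k) e false p∉ = unique-neighbour G
        (≤-pred (s≤s (<ᵇ-false (trans (≡-sym (trans (X-suc e) (cong (if_then _ else _) p∉))) v∉)))) a a′

    gain : ∀ c → 2 + c ≤ deg G root → ∀ v → X v ≡ true →
      2 + ⟦ inner v ⟧ + (if root == v then c else 0) ≤ deg G v
    gain c big v v∈ = go (dep v) refl (X (par v)) refl
      where
      go : ∀ d → dep v ≡ d → ∀ b → X (par v) ≡ b → 2 + ⟦ inner v ⟧ + (if root == v then c else 0) ≤ deg G v
      go zero    e _ _ rewrite root-unique e | ==-refl root | dep-root = big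
      go (suc k) e b p rewrite nonroot-suc e | ≢⇒== (root≢ e) | p = bound b p
        where
        bound : ∀ b → X (par v) ≡ b → 2 + ⟦ b ⟧ + 0 ≤ deg G v
        bound true  p∈ = <ᵇ-true (trans (≡-sym (trans (X-suc e) (cong (if_then _ else _) p∈))) v∈)
        bound false p∉ = <ᵇ-true (trans (≡-sym (trans (X-suc e) (cong (if_then _ else _) p∉))) v∈)

    deepCut : ∀ c → 2 + c ≤ deg G root → DeepCut G c
    deepCut c big = X , matching⇒τ≤2 matching ,
      subst (λ s → suc (card X) + s ≤ ω G X) (surplus-at (X-root dep-root) c) (ω-≥ _ (gain c big))

  -- The root and `w` are each to contribute 1. If `w` has degree 3, its parent must stay out of X,
  -- which the greedy set does not ensure; the sets below are therefore chosen by parity of the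
  -- depth.
  module TwoBranches (root-branch : 3 ≤ deg G root) (w : Fin n) (w-branch : 3 ≤ deg G w) (k₀ : ℕ) (w-deep : dep w ≡ suc k₀) where

    bonus : Fin n → ℕ
    bonus v = (if root == v then 1 else 0) + (if w == v then 1 else 0)

    bonus-root : bonus root ≡ 1
    bonus-root rewrite ==-refl root | ≢⇒== {i = w} {root} (λ q → root≢ w-deep (≡-sym q)) = refl

    bonus-other : ∀ {v k} → dep v ≡ suc k → v ≢ w → bonus v ≡ 0
    bonus-other {v} e ne rewrite ≢⇒== (root≢ e) | ≢⇒== {i = w} {v} (λ q → ne (≡-sym q)) = refl

    bonus-bound : ∀ {v k} → dep v ≡ suc k → 2 ≤ deg G v → 2 + bonus v ≤ deg G v
    bonus-bound {v} e l rewrite ≢⇒== (root≢ e) with w Fin.≟ v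
    ... | yes refl = w-branch
    ... | no _     = l

    deepCut : (X : VSet n) → X root ≡ true → X w ≡ true → Component.Matching G X →
      (∀ {v k} → dep v ≡ suc k → X v ≡ true → 2 + ⟦ X (par v) ⟧ + bonus v ≤ deg G v) → DeepCut G 2
    deepCut X root∈ w∈ matching gain = X , matching⇒τ≤2 matching ,
      subst (λ s → suc (card X) + s ≤ ω G X)
        (trans (surplus-+ (λ v → if root == v then 1 else 0) (λ v → if w == v then 1 else 0))
          (cong₂ _+_ (surplus-at root∈ 1) (surplus-at w∈ 1)))
        (ω-≥ bonus gain′)
      where
      open Component G X
      open Cut X
      gain′ : ∀ v → X v ≡ true → 2 + ⟦ inner v ⟧ + bonus v ≤ deg G v
      gain′ v v∈ = go (dep v) refl
        where
        go : ∀ d → dep v ≡ d → 2 + ⟦ inner v ⟧ + bonus v ≤ deg G v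
        go zero e rewrite root-unique e | bonus-root | dep-root = root-branch
        go (suc k) e rewrite nonroot-suc e = gain e v∈

    root-nonleaf : 2 ≤ deg G root
    root-nonleaf = ≤-trans (n≤1+n 2) root-branch

    module EvenDistance (Δ≤3 : ∀ v → deg G v ≤ 3) (w-even : even (dep w) ≡ true) where

      -- The nonleaves of even depth meet every edge except those from odd depth to leaves of even
      -- depth. A vertex of odd depth with two or more leaf neighbours would thus leave a component
      -- of order at least 3, so it is taken as well.
      X : VSet n
      X v = (1 <ᵇ leafNeighbours G v) ∨ (even (dep v) ∧ (1 <ᵇ deg G v))

      X-even : ∀ {v} → even (dep v) ≡ true → 2 ≤ deg G v → X v ≡ true
      X-even {v} e l rewrite e | <ᵇ-intro l = ∨-zeroʳ _

      even-∉ : ∀ {v} → even (dep v) ≡ true → X v ≡ false → deg G v ≤ 1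
      even-∉ e v∉ = ≮⇒≥ λ l → clash (X-even e l) v∉

      ∉-leafNeighbours : ∀ {v} → X v ≡ false → leafNeighbours G v ≤ 1
      ∉-leafNeighbours {v} v∉ = ≮⇒≥ λ l → clash (cong (_∨ (even (dep v) ∧ (1 <ᵇ deg G v))) (<ᵇ-intro l)) v∉

      ∈-nonleaf : ∀ {v} → X v ≡ true → 2 ≤ deg G v
      ∈-nonleaf {v} v∈ with ∨-true {1 <ᵇ leafNeighbours G v} v∈
      ... | inj₁ p = ≤-trans (<ᵇ-true p) (leafNeighbours-≤ G)
      ... | inj₂ p = <ᵇ-true (proj₂ (∧-true {even (dep v)} p))

      ∈-odd : ∀ {v} → even (dep v) ≡ false → X v ≡ true → 2 ≤ leafNeighbours G v
      ∈-odd {v} e v∈ with ∨-true {1 <ᵇ leafNeighbours G v} v∈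
      ... | inj₁ p = <ᵇ-true p
      ... | inj₂ p = clash (proj₁ (∧-true {even (dep v)} p)) e

      matching : Component.Matching G X
      matching {v} {x} {y} v∉ x∉ y∉ a b = go (even (dep v)) refl
        where
        go : ∀ c → even (dep v) ≡ c → x ≡ y
        go true  e = unique-neighbour G (even-∉ e v∉) a b
        go false e = unique-leaf-neighbour G (∉-leafNeighbours v∉) a b
          (even-∉ (trans (adj-parity a) (cong not e)) x∉) (even-∉ (trans (adj-parity b) (cong not e)) y∉)

      -- A parent in X would have odd depth and so two leaf neighbours, besides two nonleaf ones,
      -- its own parent and `v`: degree 4.
      parent-∉ : ∀ {v k} → dep v ≡ suc k → even (dep v) ≡ true → 2 ≤ deg G v → X (par v) ≡ false
      parent-∉ {v} {zero} e ev _ = clash ev (cong even e)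
      parent-∉ {v} {suc k} e ev l = ¬-not λ p∈ → <⇒≱
        (≤-trans (s≤s (s≤s (∈-odd (trans (adj-parity (adj-par e)) (cong not ev)) p∈)))
          (two-nonleaves⇒leafNeighbours< G
            (λ q → m≢1+n+m k {1} (trans (≡-sym (dep-par (dep-par e))) (trans (cong dep q) e)))
            (adj-par (dep-par e)) (trans (sym G (par v) v) (adj-par e))
            (parent-nonleaf root-nonleaf (dep-par e)) l))
        (Δ≤3 (par v))

      gain : ∀ {v k} → dep v ≡ suc k → X v ≡ true → 2 + ⟦ X (par v) ⟧ + bonus v ≤ deg G v
      gain {v} e v∈ = go (even (dep v)) refl
        where
        go : ∀ c → even (dep v) ≡ c → 2 + ⟦ X (par v) ⟧ + bonus v ≤ deg G v
        go true ev rewrite parent-∉ e ev (∈-nonleaf v∈) = bonus-bound e (∈-nonleaf v∈)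
        -- Two leaf neighbours and a nonleaf parent make degree 3, enough to pay for a parent in X.
        go false od rewrite bonus-other e (λ { refl → clash w-even od }) | +-identityʳ ⟦ X (par v) ⟧ =
          ≤-trans (s≤s (s≤s (⟦⟧≤1 (X (par v)))))
            (≤-trans (s≤s (∈-odd od v∈)) (nonleaf⇒leafNeighbours< G (adj-par e) (parent-nonleaf root-nonleaf e)))

      evenCut : DeepCut G 2
      evenCut = deepCut X (X-even (cong even dep-root) root-nonleaf)
        (X-even w-even (≤-trans (n≤1+n 2) w-branch)) matching gain

    -- Here the alternation along the path from the root to w is one step out
    -- of phase, so depths 1 and 2 may form components of order two.
    module OddDistance (evens-thin : ∀ {v k} → dep v ≡ suc k → even (dep v) ≡ true → deg G v ≤ 2)
      (k₁ : ℕ) (w-deep′ : dep w ≡ 3 + k₁) (k₁-even : even k₁ ≡ true) where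

      -- From depth 3 on, X consists of the nonleaves of odd depth, so that `w` is a member. A
      -- vertex of depth 1 is taken if its degree 3 or more pays for the root. A vertex of depth 2
      -- is taken if it has degree at least 2, its parent was not taken (degree below 3) and it has
      -- a leaf neighbour: left out, it would form a component of order 3 with that parent and that
      -- leaf.
      inside : ℕ → Fin n → Bool
      inside 0 v = true
      inside 1 v = 2 <ᵇ deg G v
      inside 2 v = (1 <ᵇ deg G v) ∧ ((deg G (par v) <ᵇ 3) ∧ (0 <ᵇ leafNeighbours G v))
      inside (suc (suc (suc k))) v = even k ∧ (1 <ᵇ deg G v)

      X : VSet n
      X v = inside (dep v) v

      at : ∀ {v d b} → dep v ≡ d → X v ≡ b → inside d v ≡ b
      at refl p = p

      at′ : ∀ {v d b} → dep v ≡ d → inside d v ≡ b → X v ≡ b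
      at′ refl p = p

      matching : Component.Matching G X
      matching {v} {x} {y} v∉ x∉ y∉ a b = go (dep v) refl
        where
        via-parent : ∀ {k} → dep v ≡ suc k → deg G v ≤ 2 → X (par v) ≡ true → x ≡ y
        via-parent e l p∈ = unique-other-neighbour G l (adj-par e) (member-≢ {X} p∈ x∉) (member-≢ {X} p∈ y∉) a b
        go : ∀ d → dep v ≡ d → x ≡ y
        go 0 e = clash (at′ {v} e refl) v∉
        go 1 e = via-parent e (<ᵇ-false (at {v} e v∉)) (at′ {par v} (dep-par e) refl)
        go 2 e = split (1 <ᵇ deg G v) refl (deg G (par v) <ᵇ 3) refl (0 <ᵇ leafNeighbours G v) refl
          where
          split : ∀ p → (1 <ᵇ deg G v) ≡ p → ∀ q → (deg G (par v) <ᵇ 3) ≡ q →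
            ∀ r → (0 <ᵇ leafNeighbours G v) ≡ r → x ≡ y
          split false p _ _ _ _ = unique-neighbour G (<ᵇ-false p) a b
          split true p false q _ _ = via-parent e (evens-thin e (cong even e))
            (at′ {par v} (dep-par e) (<ᵇ-intro (<ᵇ-false {deg G (par v)} {3} q)))
          split true p true q true r = clash (∧-intro p (∧-intro q r)) (at {v} e v∉)
          -- Without leaf neighbours, all children of `v` are nonleaves of depth 3 and so in X; only
          -- the parent can remain.
          split true p true q false r = trans (≡-sym (is-parent a x∉)) (is-parent b y∉)
            where
            is-parent : ∀ {z} → adj G v z ≡ true → X z ≡ false → par v ≡ z
            is-parent {z} a z∉ with edges v z a
            ... | inj₁ (_ , q) = q
            ... | inj₂ (e′ , _) = ⊥-elim (<⇒≱
              (≤-trans (s≤s z≤n) (count-∖ (λ u → adj G v u ∧ (deg G u <ᵇ 2)) z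
                (leaf-neighbour G a (<ᵇ-false (at {z} (trans e′ (cong suc e)) z∉)))))
              (<ᵇ-false r))
        go (suc (suc (suc k))) e = phase k e (even k) refl
          where
          phase : ∀ k → dep v ≡ 3 + k → ∀ c → even k ≡ c → x ≡ y
          phase k e true ev = unique-neighbour G
            (<ᵇ-false (subst (λ c → c ∧ (1 <ᵇ deg G v) ≡ false) ev (at {v} e v∉))) a b
          phase (suc j) e false od = via-parent e
            (evens-thin e (trans (cong even e) (cong (λ c → not (not (not c))) od)))
            (at′ {par v} (dep-par e) (∧-intro (not-false od) (<ᵇ-intro (parent-nonleaf root-nonleaf e))))

      -- At depth 2 the parent has degree at most 2, used up by its own parent and `v`, both
      -- nonleaves, so it has no leaf neighbour and is not taken. At even depth 4 or more nothing is
      -- taken.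
      parent-∉ : ∀ {v} j → dep v ≡ 3 + j → even j ≡ true → 2 ≤ deg G v → X (par v) ≡ false
      parent-∉ {v} zero e ev l = at′ {par v} (dep-par e) (¬-not λ p → <⇒≱
        (≤-trans (s≤s (s≤s (<ᵇ-true (proj₂ (∧-true {deg G (par (par v)) <ᵇ 3} (proj₂ (∧-true {1 <ᵇ deg G (par v)} p)))))))
          (two-nonleaves⇒leafNeighbours< G
            (λ q → m≢1+n+m 1 {1} (trans (≡-sym (dep-par (dep-par e))) (trans (cong dep q) e)))
            (adj-par (dep-par e)) (trans (sym G (par v) v) (adj-par e))
            (parent-nonleaf root-nonleaf (dep-par e)) l))
        (evens-thin (dep-par e) (cong even (dep-par e))))
      parent-∉ {v} (suc i) e ev l = at′ {par v} (dep-par e) (cong (_∧ (1 <ᵇ deg G (par v))) (not-true ev))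

      gain : ∀ {v k} → dep v ≡ suc k → X v ≡ true → 2 + ⟦ X (par v) ⟧ + bonus v ≤ deg G v
      gain {v} {k} e v∈ = go k e
        where
        shallow : ∀ {d} → dep v ≡ d → d ≤ 2 → v ≢ w
        shallow refl d≤2 refl = <⇒≱ (s≤s d≤2) (≤-trans (m≤m+n 3 k₁) (≤-reflexive (≡-sym w-deep′)))
        go : ∀ k → dep v ≡ suc k → 2 + ⟦ X (par v) ⟧ + bonus v ≤ deg G v
        go 0 e rewrite bonus-other e (shallow e (s≤s z≤n)) | +-identityʳ ⟦ X (par v) ⟧ =
          ≤-trans (s≤s (s≤s (⟦⟧≤1 (X (par v))))) (<ᵇ-true (at {v} e v∈))
        go 1 e with ∧-true {1 <ᵇ deg G v} (at {v} e v∈)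
        ... | p , q with ∧-true {deg G (par v) <ᵇ 3} q
        ...   | q , _ rewrite bonus-other e (shallow e ≤-refl)
                            | at′ {par v} (dep-par e) (¬-not λ l → <⇒≱ (<ᵇ-true q) (<ᵇ-true {2} {deg G (par v)} l)) = <ᵇ-true p
        go (suc (suc j)) e with ∧-true {even j} (at {v} e v∈)
        ... | ev , l rewrite parent-∉ j e ev (<ᵇ-true l) = bonus-bound e (<ᵇ-true l)

      oddCut : DeepCut G 2
      oddCut = deepCut X (at′ {root} dep-root refl)
        (at′ {w} w-deep′ (∧-intro k₁-even (<ᵇ-intro (≤-trans (n≤1+n 2) w-branch)))) matching gain

-- Paths

pathGraph : ∀ n → Graph n
pathGraph n = record
  { adj    = λ i j → (suc (toℕ i) ≡ᵇ toℕ j) ∨ (suc (toℕ j) ≡ᵇ toℕ i)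
  ; sym    = λ i j → ∨-comm (suc (toℕ i) ≡ᵇ toℕ j) (suc (toℕ j) ≡ᵇ toℕ i)
  ; irrefl = λ i → ¬-not λ p → case i (∨-true {suc (toℕ i) ≡ᵇ toℕ i} p) }
  where
  case : ∀ (i : Fin n) → (suc (toℕ i) ≡ᵇ toℕ i) ≡ true ⊎ (suc (toℕ i) ≡ᵇ toℕ i) ≡ true → ⊥
  case i (inj₁ q) = 1+n≢n (≡ᵇ-true {suc (toℕ i)} q)
  case i (inj₂ q) = 1+n≢n (≡ᵇ-true {suc (toℕ i)} q)

pathGraph-adj : (i j : Fin n) → adj (pathGraph n) i j ≡ true → suc (toℕ i) ≡ toℕ j ⊎ suc (toℕ j) ≡ toℕ i
pathGraph-adj i j p with ∨-true {suc (toℕ i) ≡ᵇ toℕ j} p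
... | inj₁ q = inj₁ (≡ᵇ-true {suc (toℕ i)} q)
... | inj₂ q = inj₂ (≡ᵇ-true {suc (toℕ j)} q)

pathGraph-isPath : ∀ n → IsPath (pathGraph n)
pathGraph-isPath n = Perm.id , λ i j → pathGraph-adj i j , back i j
  where
  back : ∀ (i j : Fin n) → suc (toℕ i) ≡ toℕ j ⊎ suc (toℕ j) ≡ toℕ i → adj (pathGraph n) i j ≡ true
  back i j (inj₁ q) rewrite ≡ᵇ-refl q = refl
  back i j (inj₂ q) rewrite ≡ᵇ-refl q = ∨-zeroʳ _

pathGraph-isTree : Fin n → IsTree (pathGraph n)
pathGraph-isTree {suc n} _ = Rooted.treeEdges⇒isTree rooted edges
  where
  back-one : Fin (suc n) → Fin (suc n)
  back-one zero    = zero
  back-one (suc i) = inject₁ i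
  toℕ-back : ∀ {v : Fin (suc n)} {k} → toℕ v ≡ suc k → toℕ (back-one v) ≡ k
  toℕ-back {suc i} e = trans (Fin.toℕ-inject₁ i) (suc-injective e)
  back-adj : ∀ {v : Fin (suc n)} {k} → toℕ v ≡ suc k → adj (pathGraph (suc n)) v (back-one v) ≡ true
  back-adj {v} e = proj₂ (proj₂ (pathGraph-isPath (suc n)) v (back-one v)) (inj₂ (trans (cong suc (toℕ-back {v} e)) (≡-sym e)))
  rooted : Rooted (pathGraph (suc n))
  rooted = record
    { root = zero ; par = back-one ; dep = toℕ ; dep-root = refl
    ; root-unique = Fin.toℕ-injective
    ; dep-par = λ {v} → toℕ-back {v} ; adj-par = λ {v} → back-adj {v} }
  edges : Rooted.TreeEdges rooted
  edges u v p with pathGraph-adj u v p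
  ... | inj₁ q = inj₂ (≡-sym q , Fin.toℕ-injective (toℕ-back {v} (≡-sym q)))
  ... | inj₂ q = inj₁ (≡-sym q , Fin.toℕ-injective (toℕ-back {u} (≡-sym q)))

isPath⇒Δ≤2 : (G : Graph n) → IsPath G → ∀ v → deg G v ≤ 2
isPath⇒Δ≤2 {n} G (σ , path) v = begin
  deg G v
    ≡⟨ count≡sum (adj G v) ⟩
  sumFin (λ u → ⟦ adj G v u ⟧)
    ≤⟨ sum-mono pointwise ⟩
  sumFin (λ u → ⟦ next u ⟧ + ⟦ prev u ⟧)
    ≡⟨ sum-+ (λ u → ⟦ next u ⟧) (λ u → ⟦ prev u ⟧) ⟩
  sumFin (λ u → ⟦ next u ⟧) + sumFin (λ u → ⟦ prev u ⟧)
    ≡⟨ cong₂ _+_ (count≡sum next) (count≡sum prev) ⟨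
  countFin next + countFin prev
    ≤⟨ +-mono-≤
         (count-unique next λ i j p q → index-injective (trans (≡-sym (≡ᵇ-true {suc (index v)} p)) (≡ᵇ-true {suc (index v)} q)))
         (count-unique prev λ i j p q → index-injective (suc-injective (trans (≡ᵇ-true {suc (index i)} {index v} p) (≡-sym (≡ᵇ-true {suc (index j)} {index v} q))))) ⟩
  2 ∎
  where
  open ≤-Reasoning
  index : Fin n → ℕ
  index u = toℕ (σ ⟨$⟩ˡ u)
  index-injective : ∀ {u w} → index u ≡ index w → u ≡ w
  index-injective e = trans (≡-sym (inverseʳ σ)) (trans (cong (σ ⟨$⟩ʳ_) (Fin.toℕ-injective e)) (inverseʳ σ))
  next prev : Fin n → Bool
  next u = suc (index v) ≡ᵇ index u
  prev u = suc (index u) ≡ᵇ index v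
  pointwise : ∀ u → ⟦ adj G v u ⟧ ≤ ⟦ next u ⟧ + ⟦ prev u ⟧
  pointwise u with adj G v u in eq
  ... | false = z≤n
  ... | true with proj₁ (path (σ ⟨$⟩ˡ v) (σ ⟨$⟩ˡ u))
                    (trans (cong₂ (adj G) (inverseʳ σ) (inverseʳ σ)) eq)
  ...   | inj₁ p rewrite ≡ᵇ-refl p = s≤s z≤n
  ...   | inj₂ p rewrite ≡ᵇ-refl p = m≤n+m 1 _

count-all : ∀ n → countFin {n} (λ _ → true) ≡ n
count-all zero    = refl
count-all (suc n) = cong suc (count-all n)

injective⇒preimage : (f : Fin n → Fin n) → (∀ i j → f i ≡ f j → i ≡ j) → ∀ j → ∃ λ i → f i ≡ j
injective⇒preimage {n} f inj j =
  let i , p = anyFin-elim (λ i → f i == j) (count-full image full j) in i , ==⇒≡ p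
  where
  image : Fin n → Bool
  image j = anyFin (λ i → f i == j)
  full : n ≤ countFin image
  full = ≤-trans (≤-reflexive (≡-sym (count-all n)))
    (count-injection (λ _ → true) image f (λ i _ → anyFin-intro (λ k → f k == f i) i (==-refl (f i))) (λ i j _ _ → inj i j))

n*2>2[n∸1] : 1 ≤ n → (n ∸ 1) + (n ∸ 1) < n * 2
n*2>2[n∸1] {suc n} _ = ≤-trans (n≤1+n _)
  (≤-reflexive (solve 1 (λ x → con 2 :+ (x :+ x) := (con 1 :+ x) :* con 2) refl n))
  where open +-*-Solver

-- The degrees sum to 2(n - 1), too little for n degrees of at least 2.
tree-has-leaf : Fin n → (G : Graph n) → IsTree G → ∃ λ v → deg G v ≤ 1
tree-has-leaf {n} r G (_ , size) with all-or-any (λ v → deg G v <ᵇ 2)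
... | inj₂ (v , p) = v , ≤-pred (<ᵇ-true p)
... | inj₁ none = ⊥-elim (<⇒≱ (n*2>2[n∸1] (≤-trans (s≤s z≤n) (Fin.toℕ<n r))) (begin
  n * 2                     ≡⟨ sum-const n 2 ⟨
  sumFin {n} (λ _ → 2)      ≤⟨ sum-mono {f = λ _ → 2} {g = deg G} (λ v → <ᵇ-false (none v)) ⟩
  sumFin (deg G)            ≡⟨ handshake G ⟩
  edgeCount G + edgeCount G ≡⟨ cong₂ _+_ size size ⟩
  (n ∸ 1) + (n ∸ 1)         ∎))
  where open ≤-Reasoning

module _ {G : Graph n} (R : Rooted G) (edges : Rooted.TreeEdges R) where
  open Rooted R

  -- Rooted at an end, a tree of maximum degree 2 has one vertex at each depth.
  Δ≤2⇒isPath : (∀ v → deg G v ≤ 2) → deg G root ≤ 1 → IsPath G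
  Δ≤2⇒isPath Δ≤2 end = permutation vertex position vertex-position position-vertex , λ i j → forth i j , back i j
    where
    same-depth : ∀ k {u v} → dep u ≡ k → dep v ≡ k → u ≡ v
    same-depth zero p q = trans (root-unique p) (≡-sym (root-unique q))
    same-depth (suc k) {u} {v} p q = siblings k p q (same-depth k (dep-par p) (dep-par q))
      where
      siblings : ∀ k → dep u ≡ suc k → dep v ≡ suc k → par u ≡ par v → u ≡ v
      siblings k p q e = go k p q
        where
        u-adj : adj G (par u) u ≡ true
        u-adj = trans (sym G (par u) u) (adj-par p)
        v-adj : adj G (par u) v ≡ true
        v-adj = trans (cong (λ z → adj G z v) e) (trans (sym G (par v) v) (adj-par q))
        go : ∀ k → dep u ≡ suc k → dep v ≡ suc k → u ≡ v
        go zero p q = unique-neighbour G (subst (λ z → deg G z ≤ 1) (≡-sym (root-unique (dep-par p))) end) u-adj v-adj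
        go (suc j) p q = unique-other-neighbour G (Δ≤2 (par u)) (adj-par (dep-par p)) (above p) (above q) u-adj v-adj
          where
          above : ∀ {z} → dep z ≡ suc (suc j) → par (par u) ≢ z
          above d r = m≢1+n+m j {1} (trans (≡-sym (dep-par (dep-par p))) (trans (cong dep r) d))
    ancestor : ∀ k v → dep v ≡ k → ∀ i → i ≤ k → ∃ λ u → dep u ≡ i
    ancestor zero    v e zero    _   = v , e
    ancestor (suc k) v e i i≤ with m≤n⇒m<n∨m≡n i≤
    ... | inj₁ (s≤s i≤k) = ancestor k (par v) (dep-par e) i i≤k
    ... | inj₂ refl      = v , e
    -- The ancestors of `v`, itself included, occupy all depths from 0 to `dep v`: that many
    -- distinct vertices.
    dep<n : ∀ v → dep v < n
    dep<n v = Fin.injective⇒≤ {f = λ i → proj₁ (at i)} λ {i} {j} e →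
      Fin.toℕ-injective (trans (≡-sym (proj₂ (at i))) (trans (cong dep e) (proj₂ (at j))))
      where
      at : ∀ (i : Fin (suc (dep v))) → ∃ λ u → dep u ≡ toℕ i
      at i = ancestor (dep v) v refl (toℕ i) (≤-pred (Fin.toℕ<n i))
    position : Fin n → Fin n
    position v = fromℕ< (dep<n v)
    toℕ-position : ∀ v → toℕ (position v) ≡ dep v
    toℕ-position v = Fin.toℕ-fromℕ< (dep<n v)
    position-injective : ∀ u v → position u ≡ position v → u ≡ v
    position-injective u v e = same-depth (dep v)
      (trans (≡-sym (toℕ-position u)) (trans (cong toℕ e) (toℕ-position v))) refl
    vertex : Fin n → Fin n
    vertex i = proj₁ (injective⇒preimage position position-injective i)
    position-vertex : ∀ i → position (vertex i) ≡ i
    position-vertex i = proj₂ (injective⇒preimage position position-injective i)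
    vertex-position : ∀ v → vertex (position v) ≡ v
    vertex-position v = position-injective _ v (position-vertex (position v))
    dep-vertex : ∀ i → dep (vertex i) ≡ toℕ i
    dep-vertex i = trans (≡-sym (toℕ-position (vertex i))) (cong toℕ (position-vertex i))
    one-below : ∀ i j → dep (vertex j) ≡ suc (dep (vertex i)) → suc (toℕ i) ≡ toℕ j
    one-below i j e = trans (cong suc (≡-sym (dep-vertex i))) (trans (≡-sym e) (dep-vertex j))
    forth : ∀ i j → adj G (vertex i) (vertex j) ≡ true → suc (toℕ i) ≡ toℕ j ⊎ suc (toℕ j) ≡ toℕ i
    forth i j a = Sum.map (λ (e , _) → one-below i j e) (λ (e , _) → one-below j i e) (Sum.swap (edges (vertex i) (vertex j) a))
    consecutive : ∀ i j → suc (toℕ i) ≡ toℕ j → adj G (vertex j) (vertex i) ≡ true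
    consecutive i j e = subst (λ z → adj G (vertex j) z ≡ true)
      (same-depth (toℕ i) (dep-par deeper) (dep-vertex i)) (adj-par deeper)
      where
      deeper : dep (vertex j) ≡ suc (toℕ i)
      deeper = trans (dep-vertex j) (≡-sym e)
    back : ∀ i j → suc (toℕ i) ≡ toℕ j ⊎ suc (toℕ j) ≡ toℕ i → adj G (vertex i) (vertex j) ≡ true
    back i j (inj₁ e) = trans (sym G (vertex i) (vertex j)) (consecutive i j e)
    back i j (inj₂ e) = consecutive j i e

-- Tenacity

fraction-≤ : ∀ {a b c d} → 1 ≤ b → 1 ≤ d → a * d ≤ c * b → mkℚᵘ (ℤ.+ a) (b ∸ 1) ≤ℚ mkℚᵘ (ℤ.+ c) (d ∸ 1)
fraction-≤ {a} {suc b} {c} {suc d} _ _ le =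
  *≤* (subst (ℤ._≤ ℤ.+ c ℤ.* ℤ.+ suc b) (ℤ.pos-* a (suc d))
        (subst (ℤ.+ (a * suc d) ℤ.≤_) (ℤ.pos-* c (suc b)) (ℤ.+≤+ le)))

fraction-≤⁻¹ : ∀ {a b c d} → 1 ≤ b → 1 ≤ d → mkℚᵘ (ℤ.+ a) (b ∸ 1) ≤ℚ mkℚᵘ (ℤ.+ c) (d ∸ 1) → a * d ≤ c * b
fraction-≤⁻¹ {a} {suc b} {c} {suc d} _ _ (*≤* le) =
  ℤ.drop‿+≤+ (subst (ℤ._≤ ℤ.+ (c * suc b)) (≡-sym (ℤ.pos-* a (suc d)))
    (subst (ℤ.+ a ℤ.* ℤ.+ suc d ℤ.≤_) (≡-sym (ℤ.pos-* c (suc b))) le))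

-- Every tree has a cut of ratio at most p/q, and good trees have none below it, so a good tree is
-- maximal. Conversely a maximal tree is at least as tenacious as the good tree M, which rules out a
-- cut of ratio less than p/q.
maxTenacity⇔ : (p q : ℕ) → 1 ≤ q → (Good : Graph n → Set) →
  (∀ H → IsTree H → ∃ λ X → 1 < ω H X × (card X + τ H X) * q ≤ p * ω H X) →
  (∀ H → IsTree H → Good H → ∀ X → 1 < ω H X → p * ω H X ≤ (card X + τ H X) * q) →
  (∃ λ H → IsTree H × Good H) →
  (∀ H → IsTree H → Good H ⊎ (∃ λ X → 1 < ω H X × (card X + τ H X) * q < p * ω H X)) →
  ∀ G → IsTree G → HasMaxTenacityAmongTrees G ⇔ Good G
maxTenacity⇔ {n} p q 1≤q Good upper lower (M , M-tree , M-good) dichotomy G G-tree = mk⇔ to from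
  where
  bound : ℚᵘ
  bound = mkℚᵘ (ℤ.+ p) (q ∸ 1)
  upper′ : ∀ H → IsTree H → ∃ λ X → 1 < ω H X × ratio H X ≤ℚ bound
  upper′ H tree = let X , s , le = upper H tree in X , s , fraction-≤ (<⇒≤ s) 1≤q le
  lower′ : ∀ H → IsTree H → Good H → ∀ X → 1 < ω H X → bound ≤ℚ ratio H X
  lower′ H tree good X s = fraction-≤ 1≤q (<⇒≤ s) (lower H tree good X s)
  tenacity : ∀ H → IsTree H → Good H → ∃ λ t → IsTenacity H t × bound ≤ℚ t
  tenacity H tree good = let X , s , le = upper′ H tree in
    -- `IsTenacity` demands propositional equality of unnormalised fractions, so the ratio of the
    -- minimising cut is taken as it stands and compared with p/q by inequalities only.
    ratio H X , ((X , s , refl) , λ Y s′ → ℚ.≤-trans le (lower′ H tree good Y s′)) , lower′ H tree good X s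
  to : HasMaxTenacityAmongTrees G → Good G
  to (t , (_ , t-least) , t-max) with dichotomy G G-tree
  ... | inj₁ good = good
  ... | inj₂ (X , s , lt) = let m , m-tenacity , m≥ = tenacity M M-tree M-good in
    ⊥-elim (<⇒≱ lt (fraction-≤⁻¹ 1≤q (<⇒≤ s) (ℚ.≤-trans m≥ (ℚ.≤-trans (t-max M M-tree m m-tenacity) (t-least X s)))))
  from : Good G → HasMaxTenacityAmongTrees G
  from good = let t , t-tenacity , t≥ = tenacity G G-tree good in
    t , t-tenacity , λ H tree s s-tenacity → let X , sp , le = upper′ H tree in
      ℚ.≤-trans (proj₂ s-tenacity X sp) (ℚ.≤-trans le t≥)

-- Bounds on the number of components, and the two dichotomies

half-≤ : ∀ {c h} → c + c ≤ suc (h + h) → c ≤ h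
half-≤ {c} {h} le = ≮⇒≥ λ h<c → <⇒≱ (≤-reflexive (cong suc (≡-sym (+-suc h h)))) (≤-trans (+-mono-≤ h<c h<c) le)

rooting : (G : Graph n) → IsTree G → (r : Fin n) → ∃ λ (R : Rooted G) → Rooted.root R ≡ r × Rooted.TreeEdges R
rooting G tree r = let R , e = rootAt G (proj₁ tree) r in R , e , Rooted.isTree⇒treeEdges R tree

small-cut : (G : Graph n) → IsTree G → Fin n →
  ∃ λ X → card X + card X ≤ n × card X + ω G X ≡ n × τ G X ≤ 1
small-cut G tree r =
  let R , _ , edges = rooting G tree r
      X , small , ind = Tree.small-class R edges
  in X , small , Tree.Cut.independent⇒ω R edges X ind , Component.independent⇒τ≤1 G X ind

ω>0⇒∉ : (G : Graph n) (X : VSet n) → 0 < ω G X → ∃ λ v → X v ≡ false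
ω>0⇒∉ G X p = let v , q = count-∃ _ p in v , not-true (proj₁ (∧-true {not (X v)} q))

card+ω≤n : (G : Graph n) (X : VSet n) → card X + ω G X ≤ n
card+ω≤n G X = ≤-trans (+-monoʳ-≤ (card X) (count-mono λ i p → proj₁ (∧-true {not (X i)} p))) (≤-reflexive (count-not X))

-- The value τ = 1 costs the lower bounds 1 in the numerator; the compensation is that G - X then
-- has no edges, so ω is exactly n - |X|.
τ-dichotomy : (G : Graph n) → IsTree G → (X : VSet n) → 1 < ω G X →
  2 ≤ τ G X ⊎ (τ G X ≡ 1 × card X + ω G X ≡ n)
τ-dichotomy G tree X split with 1 <? τ G X
... | yes p = inj₁ p
... | no ¬p = let v , v∉ = ω>0⇒∉ G X (<⇒≤ split) ; R , _ , edges = rooting G tree v in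
  inj₂ (≤-antisym (≮⇒≥ ¬p) (Component.τ≥1 G X v∉) ,
        Tree.Cut.independent⇒ω R edges X (Component.τ≤1⇒independent G X (≮⇒≥ ¬p)))

Δ≤2⇒ω≤ : (G : Graph n) → IsTree G → (X : VSet n) → Fin n → (∀ v → X v ≡ true → deg G v ≤ 2) → ω G X ≤ suc (card X)
Δ≤2⇒ω≤ G tree X r Δ≤2 = let R , _ , edges = rooting G tree r in
  subst (ω G X ≤_) (trans (cong (suc (card X) +_) (Tree.Cut.surplus-zero R edges X)) (+-identityʳ _))
    (Tree.Cut.ω-≤ R edges X (λ _ → 0) (λ v v∈ → ≤-trans (Δ≤2 v v∈) (≤-trans (m≤m+n 2 _) (m≤m+n _ 0))))

-- Rooted at a vertex a of degree 3 in X, every other such vertex is a child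
-- of a, so its excess degree is paid for by the edge to a inside X.
oddCondition⇒ω≤ : (G : Graph n) → IsTree G → OddCondition G → (X : VSet n) → Fin n → ω G X ≤ 2 + card X
oddCondition⇒ω≤ {n} G tree (Δ≤3 , near) X r with all-or-any (λ v → X v ∧ (2 <ᵇ deg G v))
... | inj₁ none = ≤-trans (Δ≤2⇒ω≤ G tree X r λ v v∈ → <ᵇ-false (¬-not λ p → clash (∧-intro v∈ p) (none v))) (n≤1+n _)
... | inj₂ (a , p) with ∧-true {X a} p | rooting G tree a
...   | a∈ , big | R , refl , edges = subst (ω G X ≤_)
    (trans (cong (suc (card X) +_) (surplus-at a∈ 1)) (+-comm (suc (card X)) 1)) (ω-≤ _ bound)
  where
  open Rooted R
  open Tree.Cut R edges X
  degree-3 : ∀ {v} → 2 < deg G v → deg G v ≡ 3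
  degree-3 {v} l = ≤-antisym (Δ≤3 v) l
  child : ∀ {v} → root ≢ v → 2 < deg G v → inner v ≡ true
  child {v} ne l with edges v root (near v root (λ q → ne (≡-sym q)) (degree-3 l) (degree-3 (<ᵇ-true big)))
  ... | inj₁ (e , q) = ∧-intro (nonroot-suc e) (trans (cong X q) a∈)
  ... | inj₂ (e , _) = ⊥-elim (1+n≢0 (trans (≡-sym e) dep-root))
  bound : ∀ v → X v ≡ true → deg G v ≤ 2 + ⟦ inner v ⟧ + (if root == v then 1 else 0)
  bound v v∈ with root Fin.≟ v
  ... | yes _ = ≤-trans (Δ≤3 v) (+-monoˡ-≤ 1 (m≤m+n 2 ⟦ inner v ⟧))
  ... | no ne with 2 <? deg G v
  ...   | yes l rewrite child ne l = Δ≤3 v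
  ...   | no ¬l = ≤-trans (≮⇒≥ ¬l) (≤-trans (m≤m+n 2 _) (m≤m+n _ 0))

branch-cut : (G : Graph n) → IsTree G → ∀ v c → 2 + c ≤ deg G v → DeepCut G c
branch-cut G tree v c l with rooting G tree v
... | R , refl , edges = Branching.Greedy.deepCut R edges c l

-- Any branching vertex at positive even depth may replace `w`. If there is none, `w` has odd depth,
-- at least 3 because it is not adjacent to the root, and all nonroot vertices of even depth have
-- degree at most 2.
far-branches-cut : (G : Graph n) → IsTree G → (∀ v → deg G v ≤ 3) → ∀ u w → u ≢ w →
  3 ≤ deg G u → 3 ≤ deg G w → adj G u w ≡ false → DeepCut G 2
far-branches-cut {n} G tree Δ≤3 u w u≢w u-branch w-branch far with rooting G tree u
... | R , refl , edges with all-or-any (λ v → (2 <ᵇ deg G v) ∧ (Rooted.nonroot R v ∧ even (Rooted.dep R v)))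
...   | inj₂ (v , p) =
  let l , q = ∧-true {2 <ᵇ deg G v} p
      r , e = ∧-true {Rooted.nonroot R v} q
      k , d = Rooted.nonroot-true R {v} r
  in Branching.TwoBranches.EvenDistance.evenCut R edges u-branch v (<ᵇ-true l) k d Δ≤3 e
...   | inj₁ none = by-depth (dep w) refl
  where
  open Rooted R
  thin : ∀ {v k} → dep v ≡ suc k → even (dep v) ≡ true → deg G v ≤ 2
  thin {v} d e = <ᵇ-false (¬-not λ l → clash (∧-intro l (∧-intro (nonroot-suc d) e)) (none v))
  by-depth : ∀ d → dep w ≡ d → DeepCut G 2
  by-depth 0 d = ⊥-elim (u≢w (≡-sym (root-unique d)))
  by-depth 1 d = clash (trans (sym G root w) (subst (λ z → adj G w z ≡ true) (root-unique (dep-par d)) (adj-par d))) far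
  by-depth 2 d = ⊥-elim (<⇒≱ w-branch (thin d (cong even d)))
  by-depth (suc (suc (suc k))) d = Branching.TwoBranches.OddDistance.oddCut R edges u-branch w w-branch (2 + k) d thin k d
    (¬-not λ od → <⇒≱ w-branch (thin d (trans (cong even d) (cong (λ c → not (not (not c))) od))))

path-dichotomy : Fin n → (G : Graph n) → IsTree G → IsPath G ⊎ DeepCut G 1
path-dichotomy r G tree with all-or-any (λ v → 2 <ᵇ deg G v)
... | inj₂ (v , l) = inj₂ (branch-cut G tree v 1 (<ᵇ-true l))
... | inj₁ none with tree-has-leaf r G tree
...   | v , leaf with rooting G tree v
...     | R , refl , edges = inj₁ (Δ≤2⇒isPath R edges (λ v → <ᵇ-false (none v)) leaf)

odd-dichotomy : (G : Graph n) → IsTree G → OddCondition G ⊎ DeepCut G 2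
odd-dichotomy {n} G tree with all-or-any (λ v → 3 <ᵇ deg G v)
... | inj₂ (v , l) = inj₂ (branch-cut G tree v 2 (<ᵇ-true l))
... | inj₁ thin with all-or-any (λ u → anyFin (λ w → far u w))
  where
  far : Fin n → Fin n → Bool
  far u w = ((2 <ᵇ deg G u) ∧ (2 <ᵇ deg G w)) ∧ (not (u == w) ∧ not (adj G u w))
...   | inj₁ none = inj₁ ((λ v → <ᵇ-false (thin v)) , near)
  where
  near : ∀ u w → u ≢ w → deg G u ≡ 3 → deg G w ≡ 3 → adj G u w ≡ true
  near u w ne du dw = not-false (¬-not λ na → clash (anyFin-intro _ w
    (∧-intro {(2 <ᵇ deg G u) ∧ (2 <ᵇ deg G w)}
      (∧-intro (<ᵇ-intro (≤-reflexive (≡-sym du))) (<ᵇ-intro (≤-reflexive (≡-sym dw))))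
      (∧-intro (cong not (≢⇒== ne)) na))) (none u))
...   | inj₂ (u , p) with anyFin-elim (λ w → ((2 <ᵇ deg G u) ∧ (2 <ᵇ deg G w)) ∧ (not (u == w) ∧ not (adj G u w))) p
...     | w , q =
  let b , f = ∧-true {(2 <ᵇ deg G u) ∧ (2 <ᵇ deg G w)} q
      bu , bw = ∧-true {2 <ᵇ deg G u} b
      ne , na = ∧-true {not (u == w)} f
  in inj₂ (far-branches-cut G tree (λ v → <ᵇ-false (thin v)) u w
       (λ { refl → clash (==-refl u) (not-true ne) }) (<ᵇ-true bu) (<ᵇ-true bw) (not-true na))

isPath⇒oddCondition : (G : Graph n) → IsPath G → OddCondition G
isPath⇒oddCondition G path = (λ v → ≤-trans (isPath⇒Δ≤2 G path v) (n≤1+n 2)) ,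
  λ u v _ du _ → ⊥-elim (<⇒≱ (≤-reflexive (≡-sym du)) (isPath⇒Δ≤2 G path u))

-- In the next two modules c, t and w stand for card X, τ G X and ω G X.
module OddArithmetic {n h : ℕ} (n≡ : n ≡ suc (h + h)) (c t w : ℕ) where
  open ≤-Reasoning

  upper : 1 ≤ h → c + c ≤ n → c + w ≡ n → t ≤ 1 → 1 < w × (c + t) * 1 ≤ 1 * w
  upper 1≤h small total t≤1 = ≤-trans (s≤s 1≤h) h<w , (begin
    (c + t) * 1 ≡⟨ *-identityʳ (c + t) ⟩
    c + t       ≤⟨ +-mono-≤ c≤h t≤1 ⟩
    h + 1       ≡⟨ +-comm h 1 ⟩
    suc h       ≤⟨ h<w ⟩
    w           ≡⟨ *-identityˡ w ⟨
    1 * w       ∎)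
    where
    c≤h : c ≤ h
    c≤h = half-≤ (≤-trans small (≤-reflexive n≡))
    h<w : suc h ≤ w
    h<w = +-cancelˡ-≤ c _ _ (begin
      c + suc h   ≤⟨ +-monoˡ-≤ (suc h) c≤h ⟩
      h + suc h   ≡⟨ +-suc h h ⟩
      suc (h + h) ≡⟨ trans total n≡ ⟨
      c + w       ∎)

  -- For t ≥ 2 the bound on w suffices. For t = 1, adding it to c + w ≤ n gives 2w ≤ 2h + 3, so w ≤
  -- h + 1; then c = n - w is at least h and c + 1 at least w.
  lower : c + w ≤ n → w ≤ 2 + c → 2 ≤ t ⊎ (t ≡ 1 × c + w ≡ n) → 1 * w ≤ (c + t) * 1
  lower c+w≤n w≤ d = begin
    1 * w       ≡⟨ *-identityˡ w ⟩
    w           ≤⟨ main d ⟩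
    c + t       ≡⟨ *-identityʳ (c + t) ⟨
    (c + t) * 1 ∎
    where
    w≤1+h : w ≤ suc h
    w≤1+h = half-≤ (begin
      w + w               ≤⟨ +-monoˡ-≤ w w≤ ⟩
      2 + (c + w)         ≤⟨ s≤s (s≤s c+w≤n) ⟩
      2 + n               ≡⟨ cong (2 +_) (trans n≡ (≡-sym (+-suc h h))) ⟩
      suc (suc h + suc h) ∎)
    main : 2 ≤ t ⊎ (t ≡ 1 × c + w ≡ n) → w ≤ c + t
    main (inj₁ 2≤t) = ≤-trans w≤ (≤-trans (≤-reflexive (+-comm 2 c)) (+-monoʳ-≤ c 2≤t))
    main (inj₂ (refl , total)) = begin
      w         ≤⟨ w≤1+h ⟩
      suc h     ≡⟨ +-comm 1 h ⟩
      h + 1     ≤⟨ +-monoˡ-≤ 1 (+-cancelʳ-≤ (suc h) h c (begin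
        h + suc h   ≡⟨ +-suc h h ⟩
        suc (h + h) ≡⟨ trans total n≡ ⟨
        c + w       ≤⟨ +-monoʳ-≤ c w≤1+h ⟩
        c + suc h   ∎)) ⟩
      c + 1     ∎

  deeper : t ≤ 2 → suc c + 2 ≤ w → 1 < w × (c + t) * 1 < 1 * w
  deeper t≤2 deep = ≤-trans (s≤s (≤-trans (s≤s z≤n) (m≤n+m 2 c))) deep , (begin
    suc ((c + t) * 1) ≡⟨ cong suc (*-identityʳ (c + t)) ⟩
    suc (c + t)       ≤⟨ s≤s (+-monoʳ-≤ c t≤2) ⟩
    suc c + 2         ≤⟨ deep ⟩
    w                 ≡⟨ *-identityˡ w ⟨
    1 * w             ∎)

module EvenArithmetic {n h : ℕ} (n≡ : n ≡ h + h) (c t w : ℕ) where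
  open ≤-Reasoning
  open +-*-Solver

  upper : 2 ≤ h → c + c ≤ n → c + w ≡ n → t ≤ 1 → 1 < w × (c + t) * n ≤ (2 + n) * w
  upper 2≤h small total t≤1 = ≤-trans 2≤h h≤w , (begin
    (c + t) * n       ≤⟨ *-monoˡ-≤ n (+-mono-≤ c≤h t≤1) ⟩
    (h + 1) * n       ≡⟨ cong ((h + 1) *_) n≡ ⟩
    (h + 1) * (h + h) ≡⟨ solve 1 (λ x → (x :+ con 1) :* (x :+ x) := (con 2 :+ (x :+ x)) :* x) refl h ⟩
    (2 + (h + h)) * h ≡⟨ cong (λ z → (2 + z) * h) n≡ ⟨
    (2 + n) * h       ≤⟨ *-monoʳ-≤ (2 + n) h≤w ⟩
    (2 + n) * w       ∎)
    where
    c≤h : c ≤ h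
    c≤h = half-≤ (≤-trans small (≤-trans (≤-reflexive n≡) (n≤1+n _)))
    h≤w : h ≤ w
    h≤w = +-cancelˡ-≤ c _ _ (≤-trans (+-monoˡ-≤ h c≤h) (≤-reflexive (≡-sym (trans total n≡))))

  -- Since 2w ≤ n, (n + 2)w is at most (w + 1)n, and it remains to see w + 1 ≤ c + t. For t = 1 this
  -- follows from w ≤ h, which forces c ≥ h.
  lower : c + w ≤ n → w ≤ suc c → 2 ≤ t ⊎ (t ≡ 1 × c + w ≡ n) → (2 + n) * w ≤ (c + t) * n
  lower c+w≤n w≤ d = begin
    (2 + n) * w     ≡⟨ solve 2 (λ k x → (con 2 :+ k) :* x := (x :+ x) :+ x :* k) refl n w ⟩
    (w + w) + w * n ≤⟨ +-monoˡ-≤ (w * n) (≤-trans (+-mono-≤ w≤h w≤h) (≤-reflexive (≡-sym n≡))) ⟩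
    suc w * n       ≤⟨ *-monoˡ-≤ n (main d) ⟩
    (c + t) * n     ∎
    where
    w≤h : w ≤ h
    w≤h = half-≤ (begin
      w + w       ≤⟨ +-monoˡ-≤ w w≤ ⟩
      suc (c + w) ≤⟨ s≤s c+w≤n ⟩
      suc n       ≡⟨ cong suc n≡ ⟩
      suc (h + h) ∎)
    main : 2 ≤ t ⊎ (t ≡ 1 × c + w ≡ n) → suc w ≤ c + t
    main (inj₁ 2≤t) = ≤-trans (s≤s w≤) (≤-trans (≤-reflexive (+-comm 2 c)) (+-monoʳ-≤ c 2≤t))
    main (inj₂ (refl , total)) = begin
      suc w ≤⟨ s≤s w≤h ⟩
      suc h ≡⟨ +-comm 1 h ⟩
      h + 1 ≤⟨ +-monoˡ-≤ 1 (+-cancelʳ-≤ h h c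
                 (≤-trans (≤-reflexive (≡-sym (trans total n≡))) (+-monoʳ-≤ c w≤h))) ⟩
      c + 1 ∎

  deeper : t ≤ 2 → suc c + 1 ≤ w → 1 < w × (c + t) * n < (2 + n) * w
  deeper t≤2 deep = 1<w , (begin
    -- Here c + t ≤ w, a ratio of at most 1; strictness comes from the spare 2w in (n + 2)w.
    suc ((c + t) * n) ≤⟨ s≤s (*-monoˡ-≤ n (≤-trans (+-monoʳ-≤ c t≤2) c+2≤w)) ⟩
    suc (w * n)       ≤⟨ +-monoˡ-≤ (w * n) (≤-trans (<⇒≤ 1<w) (m≤m+n w w)) ⟩
    (w + w) + w * n   ≡⟨ solve 2 (λ k x → (con 2 :+ k) :* x := (x :+ x) :+ x :* k) refl n w ⟨
    (2 + n) * w       ∎)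
    where
    c+2≤w : c + 2 ≤ w
    c+2≤w = ≤-trans (≤-reflexive (+-suc c 1)) deep
    1<w : 1 < w
    1<w = ≤-trans (m≤n+m 2 c) c+2≤w

-- The odd and the even case

max⇔oddCondition : ∀ {h} → n ≡ suc (h + h) → 1 ≤ h → Fin n → (G : Graph n) → IsTree G →
  HasMaxTenacityAmongTrees G ⇔ OddCondition G
max⇔oddCondition {n} {h} n≡ 1≤h r = maxTenacity⇔ 1 1 ≤-refl OddCondition
  (λ H tree → let X , small , total , τ≤1 = small-cut H tree r in
    X , upper (card X) (τ H X) (ω H X) 1≤h small total τ≤1)
  (λ H tree good X split → lower (card X) (τ H X) (ω H X) (card+ω≤n H X)
    (oddCondition⇒ω≤ H tree good X r) (τ-dichotomy H tree X split))
  (pathGraph n , pathGraph-isTree r , isPath⇒oddCondition (pathGraph n) (pathGraph-isPath n))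
  (λ H tree → Sum.map₂ (λ (X , τ≤2 , deep) → X , deeper (card X) (τ H X) (ω H X) τ≤2 deep) (odd-dichotomy H tree))
  where open OddArithmetic {h = h} n≡

max⇔isPath : ∀ {h} → n ≡ h + h → 2 ≤ h → Fin n → (G : Graph n) → IsTree G →
  HasMaxTenacityAmongTrees G ⇔ IsPath G
max⇔isPath {n} {h} n≡ 2≤h r = maxTenacity⇔ (2 + n) n (≤-trans (s≤s z≤n) (Fin.toℕ<n r)) IsPath
  (λ H tree → let X , small , total , τ≤1 = small-cut H tree r in
    X , upper (card X) (τ H X) (ω H X) 2≤h small total τ≤1)
  (λ H tree path X split → lower (card X) (τ H X) (ω H X) (card+ω≤n H X)
    (Δ≤2⇒ω≤ H tree X r (λ v _ → isPath⇒Δ≤2 H path v)) (τ-dichotomy H tree X split))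
  (pathGraph n , pathGraph-isTree r , pathGraph-isPath n)
  (λ H tree → Sum.map₂ (λ (X , τ≤2 , deep) → X , deeper (card X) (τ H X) (ω H X) τ≤2 deep) (path-dichotomy r H tree))
  where open EvenArithmetic {h = h} n≡

double : ∀ h → h * 2 ≡ h + h
double h = trans (*-comm h 2) (cong (h +_) (+-identityʳ h))

theorem2 : (n : ℕ) → 3 ≤ n → (G : Graph n) → IsTree G →
    ((n % 2 ≡ 0 → (HasMaxTenacityAmongTrees G ⇔ IsPath G))
    × (n % 2 ≡ 1 → (HasMaxTenacityAmongTrees G ⇔ OddCondition G)))
theorem2 n 3≤n G tree =
  (λ r → max⇔isPath {h = n / 2} (halves r)
    (≮⇒≥ λ h<2 → <⇒≱ 3≤n (≤-trans (≤-reflexive (halves r)) (+-mono-≤ (≤-pred h<2) (≤-pred h<2)))) vertex G tree) ,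
  (λ r → max⇔oddCondition {h = n / 2} (halves r)
    (≮⇒≥ λ h<1 → <⇒≱ 3≤n (≤-trans (≤-reflexive (halves r))
      (s≤s (≤-trans (+-mono-≤ (≤-pred h<1) (≤-pred h<1)) z≤n)))) vertex G tree)
  where
  vertex : Fin n
  vertex = fromℕ< (≤-trans (s≤s z≤n) 3≤n)
  halves : ∀ {b} → n % 2 ≡ b → n ≡ b + (n / 2 + n / 2)
  halves r = trans (m≡m%n+[m/n]*n n 2) (cong₂ _+_ r (double (n / 2)))
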